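{- The essential height of an $l$-generated PI-algebra satisfying an admissible polynomial identity of degree $n$, over the set of words (in the generators) of length $<n$, is less than $$\Upsilon(n,l)=8(l+1)^n n^6 l.$$
   Context: Algebras are associative. An admissible polynomial identity of degree $n$ is, in the usual sense of Shirshov, a polynomial identity of degree $n$ in which some monomial of highest degree has coefficient $1$. Words are monomials in the $l$ generators. Essential height: an algebra $A$ has essential height $h$ over a finite set $Y\subset A$ if one can choose a finite set $D\subset A$ such that $A$ is linearly spanned by elements of the form $t_1t_2\cdots t_s$ with $s\le 2h+1$, where for each $i$ either $t_i\in D$ or $t_i=y_i^{k_i}$ with $y_i\in Y$, and the set of indices $i$ with $t_i\notin D$ has at most $h$ elements; the essential height is the least such $h$. -}

module Defs where

open import Level using (Level; _⊔_) renaming (suc to lsuc)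
open import Algebra.Bundles using (CommutativeRing)
open import Algebra.Core using (Op₂)
open import Algebra.Module.Bundles using (Module)
open import Algebra.Structures using (IsRingWithoutOne)
open import Data.Bool using (if_then_else_)
open import Data.Fin using (Fin)
open import Data.List using (List; []; _∷_)
import Data.List.Membership.Setoid as Membership
import Data.List.Properties as List
open import Data.List.NonEmpty as List⁺ using (List⁺; _∷_; toList)
open import Data.Nat using (ℕ; zero; suc; _+_; _*_; _^_; _≤_; _<_)
import Data.Nat.Properties as ℕ
open import Data.Product using (∃-syntax; _×_; _,_)
open import Relation.Binary.PropositionalEquality using (_≡_)
open import Relation.Nullary using (does)
open import Relation.Unary using (Pred)

private variable
  c ℓ m ℓm p : Level

-- Algebras need not be unital, so words, being monomials, are nonempty.
Word : ∀ {a} → Set a → Set a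
Word = List⁺

-- The free associative algebra over R on the letters x₀, x₁, x₂, …

module _ (R : CommutativeRing c ℓ) where
  open CommutativeRing R using (Carrier; 0#; 1#; _≈_) renaming (_+_ to _+ᴿ_)

  -- Formal sums of terms; the same word may occur in several terms, so
  -- only `coefficient` is meaningful.
  Polynomial : Set c
  Polynomial = List (Carrier × Word ℕ)

  coefficient : Polynomial → Word ℕ → Carrier
  coefficient []            w = 0#
  coefficient ((r , u) ∷ f) w =
    (if does (List.≡-dec ℕ._≟_ (toList u) (toList w)) then r else 0#)
      +ᴿ coefficient f w

  -- When 1# is nonzero these two conditions force the degree of f to be
  -- exactly n.
  Admissible : Polynomial → ℕ → Set ℓ
  Admissible f n =
      (∀ w → n < List⁺.length w → coefficient f w ≈ 0#)
    × (∃[ w ] (List⁺.length w ≡ n × coefficient f w ≈ 1#))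

record AssociativeAlgebra (R : CommutativeRing c ℓ) m ℓm
       : Set (c ⊔ ℓ ⊔ lsuc (m ⊔ ℓm)) where
  infixl 7 _∙_

  field
    asModule : Module R m ℓm

  open Module asModule public

  field
    _∙_              : Op₂ Carrierᴹ
    isRingWithoutOne : IsRingWithoutOne _≈ᴹ_ _+ᴹ_ _∙_ -ᴹ_ 0ᴹ
    *ₗ-∙-assoc       : ∀ r x y → ((r *ₗ x) ∙ y) ≈ᴹ (r *ₗ (x ∙ y))
    ∙-*ₗ-comm        : ∀ r x y → (x ∙ (r *ₗ y)) ≈ᴹ (r *ₗ (x ∙ y))

module _ {R : CommutativeRing c ℓ} (A : AssociativeAlgebra R m ℓm) where
  open CommutativeRing R using (Carrier)
  open AssociativeAlgebra A
  open Membership (≈ᴹ-setoid) using (_∈_)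

  product : List⁺ Carrierᴹ → Carrierᴹ
  product = List⁺.foldr₁ _∙_

  evalWord : ∀ {a} {X : Set a} → (X → Carrierᴹ) → Word X → Carrierᴹ
  evalWord ρ w = product (List⁺.map ρ w)

  evalPolynomial : (ℕ → Carrierᴹ) → Polynomial R → Carrierᴹ
  evalPolynomial ρ []            = 0ᴹ
  evalPolynomial ρ ((r , u) ∷ f) = (r *ₗ evalWord ρ u) +ᴹ evalPolynomial ρ f

  IsIdentity : Polynomial R → Set (m ⊔ ℓm)
  IsIdentity f = ∀ ρ → evalPolynomial ρ f ≈ᴹ 0ᴹ

  data Subalgebra {l} (g : Fin l → Carrierᴹ) : Pred Carrierᴹ (c ⊔ m ⊔ ℓm) where
    generator : ∀ i → Subalgebra g (g i)
    zero      : Subalgebra g 0ᴹ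
    add       : ∀ {x y} → Subalgebra g x → Subalgebra g y → Subalgebra g (x +ᴹ y)
    scale     : ∀ r {x} → Subalgebra g x → Subalgebra g (r *ₗ x)
    multiply  : ∀ {x y} → Subalgebra g x → Subalgebra g y → Subalgebra g (x ∙ y)
    resp      : ∀ {x y} → x ≈ᴹ y → Subalgebra g x → Subalgebra g y

  Generates : ∀ {l} → (Fin l → Carrierᴹ) → Set (c ⊔ m ⊔ ℓm)
  Generates g = ∀ a → Subalgebra g a

  data Span (P : Pred Carrierᴹ p) : Pred Carrierᴹ (c ⊔ m ⊔ ℓm ⊔ p) where
    element : ∀ {x} → P x → Span P x
    zero    : Span P 0ᴹ
    add     : ∀ {x y} → Span P x → Span P y → Span P (x +ᴹ y)
    scale   : ∀ r {x} → Span P x → Span P (r *ₗ x)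
    resp    : ∀ {x y} → x ≈ᴹ y → Span P x → Span P y

  WordsShorterThan : ∀ {l} → ℕ → (Fin l → Carrierᴹ) → Pred Carrierᴹ ℓm
  WordsShorterThan n g a =
    ∃[ w ] (List⁺.length w < n × a ≈ᴹ evalWord g w)

  -- y ^⁺ k is the (k + 1)-st power of y.
  _^⁺_ : Carrierᴹ → ℕ → Carrierᴹ
  y ^⁺ zero  = y
  y ^⁺ suc k = y ∙ (y ^⁺ k)

  -- A factor records whether it is taken from D or is a power of an element
  -- of Y, membership in D being undecidable in general.  Factors lying in D
  -- can always be recorded as such, so bounding the number of factors
  -- recorded as powers is the same as bounding the number of factors
  -- outside D.
  data Factor (Y : Pred Carrierᴹ p) (D : List Carrierᴹ) : Set (m ⊔ ℓm ⊔ p) where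
    fromD : ∀ {d} → d ∈ D → Factor Y D
    power : ∀ {y} → Y y → ℕ → Factor Y D

  module _ {Y : Pred Carrierᴹ p} {D : List Carrierᴹ} where

    value : Factor Y D → Carrierᴹ
    value (fromD {d} _)   = d
    value (power {y} _ k) = y ^⁺ k

    countPowers : List (Factor Y D) → ℕ
    countPowers []               = 0
    countPowers (fromD _ ∷ ts)   = countPowers ts
    countPowers (power _ _ ∷ ts) = suc (countPowers ts)

  EssentialProduct : Pred Carrierᴹ p → List Carrierᴹ → ℕ →
                     Pred Carrierᴹ (m ⊔ ℓm ⊔ p)
  EssentialProduct Y D h a =
    ∃[ ts ] ( List⁺.length ts ≤ 2 * h + 1
            × countPowers {Y = Y} {D = D} (toList ts) ≤ h
            × a ≈ᴹ product (List⁺.map value ts))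

  EssentialHeightAtMost : Pred Carrierᴹ p → ℕ → Set (c ⊔ m ⊔ ℓm ⊔ p)
  EssentialHeightAtMost Y h =
    ∃[ D ] (∀ a → Span (EssentialProduct Y D h) a)

  IsEssentialHeight : Pred Carrierᴹ p → ℕ → Set (c ⊔ m ⊔ ℓm ⊔ p)
  IsEssentialHeight Y h =
      EssentialHeightAtMost Y h
    × (∀ h′ → EssentialHeightAtMost Y h′ → h ≤ h′)

  -- The least suitable h cannot be computed constructively in general, so
  -- the first component asserts that some suitable h lies below N (whence,
  -- classically, the least one exists and is below N).
  EssentialHeightLessThan : Pred Carrierᴹ p → ℕ → Set (c ⊔ m ⊔ ℓm ⊔ p)
  EssentialHeightLessThan Y N =
      (∃[ h ] (h < N × EssentialHeightAtMost Y h))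
    × (∀ h → IsEssentialHeight Y h → h < N)

Υ : ℕ → ℕ → ℕ
Υ n l = 8 * (l + 1) ^ n * n ^ 6 * l

module Submission where

-- Inclusion–exclusion over substitutions of 0 turns the identity into a
-- multilinear one, so a product y₁⋯yₙ is a combination of the products
-- y_σ(1)⋯y_σ(n) with σ ≠ id.  Hence a word s u₁⋯uₙ with u₁ ≻ ⋯ ≻ uₙ, where ≻
-- compares words at the first letter in which they differ, is a combination of
-- lexicographically smaller words of the same length, and the algebra is spanned
-- by the words that are not divisible in this sense.
--
-- If n disjoint copies of a word v occur in w and v has n pairwise comparable
-- factors, then w is divisible: take the largest factor in the first copy, the
-- second largest in the second copy, and so on.  Two kinds of v are used.  In a
-- word of length n + n² the factors of length n² at the first n positions are
-- either distinct, or the word contains uⁿ with |u| < n; words of the first kind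
-- only contribute to gaps of bounded length.  A run of the period u that is
-- broken by a letter x different from the first letter of u contains the
-- comparable words x, ux, …, uⁿ⁻¹x.  As there are at most (l + 1)ⁿ l pairs
-- (u , x), an indivisible word has at most n (l + 1)ⁿ l broken runs, and one more
-- run at its end.

open import Defs
open import Algebra.Bundles using (CommutativeMonoid; CommutativeRing)
import Algebra.Properties.CommutativeSemigroup as CommutativeSemigroupProperties
open import Algebra.Structures using (IsRingWithoutOne)
open import Data.Bool using (if_then_else_)
open import Data.Fin as Fin using (Fin)
import Data.Fin.Induction as Fin
import Data.Fin.Properties as Fin
open import Data.List
  using (List; []; _∷_; _++_; [_]; length; map; concat; replicate; take; drop; foldr;
         tabulate; lookup; filter; applyUpTo; allFin; cartesianProductWith)
import Data.List.Membership.DecPropositional as DecMembership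
open import Data.List.Membership.Propositional using (_∈_)
open import Data.List.Membership.Propositional.Properties
  using (∈-allFin; ∈-cartesianProductWith⁺; ∈-cartesianProductWith⁻; ∈-filter⁺; ∈-filter⁻;
         ∈-map⁺; ∈-map⁻; ∈-++⁺ˡ; ∈-++⁺ʳ; ∈-∃++)
import Data.List.Membership.Setoid as Membership
open import Data.List.NonEmpty as List⁺
  using (_∷_; toList; _∷⁺_; _++⁺_; _⁺++⁺_)
import Data.List.Properties as List
open import Data.List.Relation.Binary.Permutation.Propositional
  using (_↭_; ↭-refl; ↭-sym; ↭-trans; prep; swap)
import Data.List.Relation.Binary.Permutation.Propositional.Properties as Perm
open import Data.List.Relation.Binary.Pointwise using (Pointwise; []; _∷_; Pointwise-length)
open import Data.List.Relation.Unary.All as All using (All; []; _∷_)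
import Data.List.Relation.Unary.All.Properties as All
open import Data.List.Relation.Unary.AllPairs using (AllPairs; []; _∷_)
import Data.List.Relation.Unary.AllPairs.Properties as AllPairs
open import Data.List.Relation.Unary.Any as Any using (here; there)
open import Data.List.Relation.Unary.Unique.Propositional using (Unique)
import Data.List.Relation.Unary.Unique.Propositional.Properties as Unique
open import Data.Nat
open import Data.Nat.Induction using (<-wellFounded)
open import Data.Nat.ListAction using (sum)
open import Data.Nat.ListAction.Properties using (sum-↭)
open import Data.Nat.Properties as ℕ
open import Data.Product using (∃-syntax; _×_; _,_; proj₁; proj₂)
open import Data.Sum as Sum using (_⊎_; inj₁; inj₂)
open import Function using (_∘_; _on_; flip)
open import Induction.WellFounded using (Acc; acc; WellFounded)
open import Level using (Level)
open import Relation.Binary using (tri<; tri≈; tri>; DecidableEquality)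
open import Relation.Binary.PropositionalEquality hiding ([_]; resp)
import Relation.Binary.Reasoning.Setoid as SetoidReasoning
open import Relation.Nullary using (¬_; yes; no; contradiction; ¬?; does)
open import Relation.Nullary.Decidable using (dec-true; dec-false)
open import Relation.Unary using (Pred; Decidable)

private variable
  a b p q c ℓ m ℓm : Level
  X Z : Set a
  l : ℕ

-- Comparison of words

infix 4 _≻_ _#_

-- A proper prefix is incomparable with the word it begins, so that both
-- arguments may be extended on the right.
data _≻_ {l} : List (Fin l) → List (Fin l) → Set where
  here  : ∀ {x y xs ys} → y Fin.< x → x ∷ xs ≻ y ∷ ys
  there : ∀ {x xs ys} → xs ≻ ys → x ∷ xs ≻ x ∷ ys

_#_ : List (Fin l) → List (Fin l) → Set
u # v = u ≻ v ⊎ v ≻ u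

≻-trans : {u v w : List (Fin l)} → u ≻ v → v ≻ w → u ≻ w
≻-trans (here p)  (here q)  = here (ℕ.<-trans q p)
≻-trans (here p)  (there _) = here p
≻-trans (there _) (here q)  = here q
≻-trans (there p) (there q) = there (≻-trans p q)

≻-++ʳ : {u v : List (Fin l)} → u ≻ v → ∀ s t → u ++ s ≻ v ++ t
≻-++ʳ (here p)  s t = here p
≻-++ʳ (there p) s t = there (≻-++ʳ p s t)

≻-++ˡ : ∀ (s : List (Fin l)) {u v} → u ≻ v → s ++ u ≻ s ++ v
≻-++ˡ []      p = p
≻-++ˡ (x ∷ s) p = there (≻-++ˡ s p)

#-++ˡ : ∀ (s : List (Fin l)) {u v} → u # v → s ++ u # s ++ v
#-++ˡ s = Sum.map (≻-++ˡ s) (≻-++ˡ s)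

heads-# : ∀ {x y : Fin l} {xs ys} → x ≢ y → x ∷ xs # y ∷ ys
heads-# {x = x} {y} x≢y with Fin.<-cmp x y
... | tri< x<y _ _ = inj₂ (here x<y)
... | tri≈ _ x≡y _ = contradiction x≡y x≢y
... | tri> _ _ y<x = inj₁ (here y<x)

-- Two different words of the same length cannot be prefixes of one another, so they differ at some
-- letter, and the first such letter decides.
equal-length-# : (u v : List (Fin l)) → length u ≡ length v → u ≢ v → u # v
equal-length-# []      []      _  u≢v = contradiction refl u≢v
equal-length-# (x ∷ u) (y ∷ v) eq u≢v with x Fin.≟ y
... | no  x≢y  = heads-# x≢y
... | yes refl =
  #-++ˡ [ x ] (equal-length-# u v (suc-injective eq) (u≢v ∘ cong (x ∷_)))

-- Fixing the length makes descent possible: for ≻ alone there are infinite chains such as 1 ≻ 01 ≻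
-- 001 ≻ ⋯.
_⋗_ : List (Fin l) → List (Fin l) → Set
u ⋗ v = u ≻ v × length v ≡ length u

⋗-wellFounded : WellFounded (flip (_⋗_ {l}))
⋗-wellFounded w = go (length w) w refl
  where
  cons : ∀ {k} {x : Fin l} {w} →
         (∀ v → length v ≡ k → Acc (flip _⋗_) v) → length w ≡ k →
         Acc Fin._<_ x → Acc (flip _⋗_) w →
         ∀ {v} → (x ∷ w) ⋗ v → Acc (flip _⋗_) v
  -- When the first letter drops, the tail may become any word of length k; `shorter` makes that
  -- tail accessible.
  cons shorter |w|≡k (acc rx) _ {y ∷ v} (here y<x , eq) =
    acc (cons shorter |v|≡k (rx y<x) (shorter v |v|≡k))
    where |v|≡k = trans (suc-injective eq) |w|≡k
  cons shorter |w|≡k (acc rx) (acc rw) (there w≻v , eq) =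
    acc (cons shorter (trans (suc-injective eq) |w|≡k) (acc rx)
              (rw (w≻v , suc-injective eq)))

  go : ∀ k (w : List (Fin l)) → length w ≡ k → Acc (flip _⋗_) w
  go zero    []      _  = acc λ ()
  go (suc k) (x ∷ w) eq =
    acc (cons (go k) (suc-injective eq) (Fin.<-wellFounded x) (go k w (suc-injective eq)))

-- Insertion sort works although ≻ is only a partial order, because the words at hand are pairwise
-- comparable.
insert-descending : ∀ (f : List (Fin l)) fs → All (f #_) fs → AllPairs _≻_ fs →
                    ∃[ gs ] (gs ↭ f ∷ fs × AllPairs _≻_ gs)
insert-descending f []       []                  []          =
  [ f ] , ↭-refl , [] ∷ []
insert-descending f (h ∷ fs) (inj₁ f≻h ∷ _)      (h≻ ∷ fs≻)  =
  f ∷ h ∷ fs , ↭-refl , (f≻h ∷ All.map (≻-trans f≻h) h≻) ∷ h≻ ∷ fs≻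
insert-descending f (h ∷ fs) (inj₂ h≻f ∷ f#)     (h≻ ∷ fs≻)
  with gs , gs↭ , gs≻ ← insert-descending f fs f# fs≻ =
  h ∷ gs , ↭-trans (prep h gs↭) (swap h f ↭-refl) ,
  Perm.All-resp-↭ (↭-sym gs↭) (h≻f ∷ h≻) ∷ gs≻

sort-descending : ∀ (fs : List (List (Fin l))) → AllPairs _#_ fs →
                  ∃[ gs ] (gs ↭ fs × AllPairs _≻_ gs)
sort-descending []       []         = [] , ↭-refl , []
sort-descending (f ∷ fs) (f# ∷ fs#)
  with gs , gs↭ , gs≻ ← sort-descending fs fs#
  with hs , hs↭ , hs≻ ←
       insert-descending f gs (Perm.All-resp-↭ (↭-sym gs↭) f#) gs≻ =
  hs , ↭-trans hs↭ (prep f gs↭) , hs≻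

-- Disjoint factors and divisible words

Factor-of : List X → List X → Set _
Factor-of v f = ∃[ s ] ∃[ t ] (v ≡ s ++ f ++ t)

infix 4 _Contains_

data _Contains_ {X : Set a} : List X → List (List X) → Set a where
  []    : ∀ {w} → w Contains []
  split : ∀ {w c w′ cs} s → w ≡ s ++ c ++ w′ → w′ Contains cs →
          w Contains (c ∷ cs)

++-Contains : ∀ (s : List X) {w cs} → w Contains cs → (s ++ w) Contains cs
++-Contains s []              = []
++-Contains s (split s′ eq p) =
  split (s ++ s′) (trans (cong (s ++_) eq) (sym (List.++-assoc s s′ _))) p

Contains-filter : {P : Pred (List X) p} (P? : Decidable P) {w : List X} →
                  ∀ {cs} → w Contains cs → w Contains filter P? cs
Contains-filter P? []                      = []
Contains-filter P? (split {c = c} s eq p) with P? c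
... | yes _ = split s eq (Contains-filter P? p)
... | no  _ = subst (_Contains _) (sym eq)
                (++-Contains s (++-Contains c (Contains-filter P? p)))

-- Each factor is found in a copy of v of its own, and the rest of that copy is skipped. The order
-- of `fs` is therefore free, whatever the positions of the factors inside v.
Contains-factors : ∀ {v : List X} {w cs} fs → w Contains cs → All (_≡ v) cs →
                   length fs ≤ length cs → All (Factor-of v) fs → w Contains fs
Contains-factors []       _  _ _ _ = []
Contains-factors {v = v} {w} (f ∷ fs) (split {w′ = w′} s eq p) (refl ∷ cs≡v)
  (s≤s le) ((b , t , v≡) ∷ fs⊑) =
  split (s ++ b) w≡ (++-Contains t (Contains-factors fs p cs≡v le fs⊑))
  where
  open ≡-Reasoning
  w≡ : w ≡ (s ++ b) ++ f ++ t ++ w′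
  w≡ = begin
    w                         ≡⟨ eq ⟩
    s ++ v ++ w′              ≡⟨ cong (λ z → s ++ z ++ w′) v≡ ⟩
    s ++ (b ++ f ++ t) ++ w′  ≡⟨ cong (s ++_) (List.++-assoc b (f ++ t) w′) ⟩
    s ++ b ++ (f ++ t) ++ w′  ≡⟨ cong (λ z → s ++ b ++ z) (List.++-assoc f t w′) ⟩
    s ++ b ++ f ++ t ++ w′    ≡⟨ List.++-assoc s b _ ⟨
    (s ++ b) ++ f ++ t ++ w′  ∎

Extends : List X → Word X → Set _
Extends f u = ∃[ t ] (toList u ≡ f ++ t)

-- Each factor is prolonged to the right up to the beginning of the next one, the last up to the end
-- of w. The prolonged words then fill a whole suffix of w.
Contains⇒suffix : ∀ {w : List X} {fs} → w Contains fs →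
                  All (λ f → 0 < length f) fs →
                  ∃[ s ] ∃[ us ] (w ≡ s ++ concat (map toList us) × Pointwise Extends fs us)
Contains⇒suffix {w = w} [] [] = w , [] , sym (List.++-identityʳ w) , []
Contains⇒suffix (split {c = x ∷ f} s refl p) (_ ∷ fs>0)
  with s′ , us , refl , fs⊑us ← Contains⇒suffix p fs>0 =
  s , (x ∷ f ++ s′) ∷ us ,
  cong (s ++_) (sym (List.++-assoc (x ∷ f) s′ _)) ,
  (s′ , refl) ∷ fs⊑us

≻-Extends : {f g : List (Fin l)} {u v : Word (Fin l)} → f ≻ g →
            Extends f u → Extends g v → toList u ≻ toList v
≻-Extends f≻g (s , u≡) (t , v≡) = subst₂ _≻_ (sym u≡) (sym v≡) (≻-++ʳ f≻g s t)

descending-Extends : ∀ {fs : List (List (Fin l))} {us} → AllPairs _≻_ fs →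
                     Pointwise Extends fs us → AllPairs (_≻_ on toList) us
descending-Extends []         []              = []
descending-Extends (f≻ ∷ fs≻) (f⊑u ∷ fs⊑us) =
  below f⊑u f≻ fs⊑us ∷ descending-Extends fs≻ fs⊑us
  where
  below : ∀ {f : List (Fin l)} {u fs us} → Extends f u → All (f ≻_) fs →
          Pointwise Extends fs us → All (λ v → toList u ≻ toList v) us
  below f⊑u []          []            = []
  below f⊑u (f≻g ∷ f≻) (g⊑v ∷ gs⊑vs) = ≻-Extends f≻g f⊑u g⊑v ∷ below f⊑u f≻ gs⊑vs

-- The last of the words `us` reaches the end of w. This costs no generality, because ≻ persists
-- when words are extended on the right.
Divisible : ℕ → List (Fin l) → Set
Divisible n w = ∃[ s ] ∃[ us ]
  (w ≡ s ++ concat (map toList us) × length us ≡ n × AllPairs (_≻_ on toList) us)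

Rich : ℕ → List (Fin l) → Set
Rich n v = ∃[ fs ]
  (length fs ≡ n × AllPairs _#_ fs × All (λ f → 0 < length f × Factor-of v f) fs)

rich-copies⇒Divisible : ∀ {n} {v w : List (Fin l)} {cs} → Rich n v →
                        w Contains cs → All (_≡ v) cs → n ≤ length cs → Divisible n w
rich-copies⇒Divisible {n = n} {v} {w} {cs} (fs , refl , fs# , fs⊑) p cs≡v le
  with gs , gs↭ , gs≻ ← sort-descending fs fs#
  with gs>0⊑ ← Perm.All-resp-↭ (↭-sym gs↭) fs⊑
  with s , us , w≡ , gs⊑us ← Contains⇒suffix
         (Contains-factors gs p cs≡v
           (≤-trans (≤-reflexive (Perm.↭-length gs↭)) le) (All.map proj₂ gs>0⊑))
         (All.map proj₁ gs>0⊑) =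
  s , us , w≡ , trans (sym (Pointwise-length gs⊑us)) (Perm.↭-length gs↭) ,
  descending-Extends gs≻ gs⊑us

-- Powers and periods

pow : List X → ℕ → List X
pow u k = concat (replicate k u)

pow-+ : ∀ (u : List X) m k → pow u (m + k) ≡ pow u m ++ pow u k
pow-+ u zero    k = refl
pow-+ u (suc m) k = trans (cong (u ++_) (pow-+ u m k)) (sym (List.++-assoc u _ _))

pow-rotate : ∀ (s t : List X) k → pow (s ++ t) k ++ s ≡ s ++ pow (t ++ s) k
pow-rotate s t zero    = sym (List.++-identityʳ s)
pow-rotate s t (suc k) = begin
  ((s ++ t) ++ pow (s ++ t) k) ++ s ≡⟨ List.++-assoc (s ++ t) _ s ⟩
  (s ++ t) ++ pow (s ++ t) k ++ s   ≡⟨ cong ((s ++ t) ++_) (pow-rotate s t k) ⟩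
  (s ++ t) ++ s ++ pow (t ++ s) k   ≡⟨ List.++-assoc s t _ ⟩
  s ++ t ++ s ++ pow (t ++ s) k     ≡⟨ cong (s ++_) (List.++-assoc t s _) ⟨
  s ++ (t ++ s) ++ pow (t ++ s) k   ∎
  where open ≡-Reasoning

length-pow : ∀ (u : List X) k → length (pow u k) ≡ k * length u
length-pow u zero    = refl
length-pow u (suc k) = trans (List.length-++ u) (cong (length u +_) (length-pow u k))

take-++-≤ : ∀ d (xs ys : List X) → length xs ≤ d →
            take d (xs ++ ys) ≡ xs ++ take (d ∸ length xs) ys
take-++-≤ d       []       ys _        = refl
take-++-≤ (suc d) (x ∷ xs) ys (s≤s le) = cong (x ∷_) (take-++-≤ d xs ys le)

-- The hypothesis says that u ++ r has period |u| on a long initial part. A power of u at the start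
-- of u ++ r that lies within the first d letters reappears at the start of r, hence after one more
-- u.
period⇒pow : ∀ {d} {u r : List X} → take d (u ++ r) ≡ take d r →
             ∀ m → m * length u ≤ d → ∃[ t ] (u ++ r ≡ pow u m ++ t)
period⇒pow             eq zero    _  = _ , refl
period⇒pow {d = d} {u} {r} eq (suc m) le
  with t , s≡ ← period⇒pow eq m (≤-trans (m≤n+m _ (length u)) le) = t′ , (begin
    u ++ r                             ≡⟨ cong (u ++_) (List.take++drop≡id d r) ⟨
    u ++ take d r ++ drop d r          ≡⟨ cong (λ z → u ++ z ++ drop d r) eq ⟨
    u ++ take d (u ++ r) ++ drop d r   ≡⟨ cong (λ z → u ++ take d z ++ drop d r) s≡ ⟩
    u ++ take d (pow u m ++ t) ++ drop d r
      ≡⟨ cong (λ z → u ++ z ++ drop d r) (take-++-≤ d (pow u m) t short) ⟩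
    u ++ (pow u m ++ t″) ++ drop d r   ≡⟨ cong (u ++_) (List.++-assoc (pow u m) t″ _) ⟩
    u ++ pow u m ++ t′                 ≡⟨ List.++-assoc u (pow u m) t′ ⟨
    (u ++ pow u m) ++ t′               ∎)
  where
  open ≡-Reasoning
  t″ = take (d ∸ length (pow u m)) t
  t′ = t″ ++ drop d r
  short : length (pow u m) ≤ d
  short = subst (_≤ d) (sym (length-pow u m)) (≤-trans (m≤n+m _ (length u)) le)

_≟ʷ_ : DecidableEquality (List (Fin l))
_≟ʷ_ = List.≡-dec Fin._≟_

-- Two occurrences of one word of length d at distance q give the period q. The first q letters
-- serve as u, and n q ≤ d leaves room for n repetitions.
repetition⇒pow : ∀ {n d q} (s : List X) → 0 < q → q ≤ length s → q < n → n * q ≤ d →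
                 take d s ≡ take d (drop q s) →
                 ∃[ u ] ∃[ t ] (s ≡ pow (toList u) n ++ t × List⁺.length u < n)
repetition⇒pow {n = n} {d} {q} s 0<q q≤|s| q<n nq≤d eq
  with take q s | List.take++drop≡id q s |
       trans (List.length-take q s) (m≤n⇒m⊓n≡m q≤|s|)
... | []    | _  | refl = contradiction 0<q λ ()
... | x ∷ u | s≡ | refl
  with t , s≡′ ← period⇒pow {d = d} {u = x ∷ u} {r = drop q s}
                   (trans (cong (take d) s≡) eq) n nq≤d =
  x ∷ u , t , trans (sym s≡) s≡′ , q<n

-- Among the factors of length n² starting at the first n positions either all
-- are distinct, or two coincide and produce a period shorter than n.
window : ∀ n .{{_ : NonZero n}} (v : List (Fin l)) → length v ≡ n + n * n →
         Rich n v ⊎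
         (∃[ g ] ∃[ u ] ∃[ r ] (v ≡ g ++ pow (toList u) n ++ r ×
                                length g < n × List⁺.length u < n))
window {l} n v |v|≡ with anyUpTo? (λ j → anyUpTo? (λ i →
  take (n * n) (drop i v) ≟ʷ take (n * n) (drop j v)) j) n
... | no none = inj₁ (applyUpTo F n , List.length-applyUpTo F n ,
        AllPairs.applyUpTo⁺₁ F n (λ i<j j<n →
          equal-length-# _ _ (trans (|F| (<-trans i<j j<n)) (sym (|F| j<n)))
            (λ eq → none (_ , j<n , _ , i<j , eq))) ,
        All.applyUpTo⁺₁ F n (λ {i} i<n → subst (0 <_) (sym (|F| i<n)) 0<n² , factor i))
  where
  F : ℕ → List (Fin l)
  F i = take (n * n) (drop i v)
  0<n² : 0 < n * n
  0<n² = >-nonZero⁻¹ (n * n) {{m*n≢0 n n}}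
  |F| : ∀ {i} → i < n → length (F i) ≡ n * n
  |F| {i} i<n = trans (List.length-take (n * n) (drop i v)) (m≤n⇒m⊓n≡m
    (subst (n * n ≤_) (sym (trans (List.length-drop i v) (cong (_∸ i) |v|≡)))
      (≤-trans (≤-reflexive (sym (m+n∸m≡n n (n * n)))) (∸-monoʳ-≤ (n + n * n) (<⇒≤ i<n)))))
  factor : ∀ i → Factor-of v (F i)
  factor i = take i v , drop (n * n) (drop i v) , sym (trans
    (cong (take i v ++_) (List.take++drop≡id (n * n) (drop i v))) (List.take++drop≡id i v))
... | yes (j , j<n , i , i<j , eq)
  -- The period is the distance `j ∸ i`, which is less than n, so that n periods fit into the n²
  -- letters that agree.
  with u , t , s≡ , |u|<n ← repetition⇒pow {d = n * n} {q = j ∸ i} (drop i v)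
         (m<n⇒0<n∸m i<j)
         (subst (j ∸ i ≤_) (sym (List.length-drop i v)) (∸-monoˡ-≤ i
           (≤-trans (<⇒≤ j<n) (subst (n ≤_) (sym |v|≡) (m≤m+n n (n * n))))))
         (≤-<-trans (m∸n≤m j i) j<n)
         (*-monoʳ-≤ n (<⇒≤ (≤-<-trans (m∸n≤m j i) j<n)))
         (trans eq (cong (take (n * n)) (sym (trans (List.drop-drop i (j ∸ i) v)
           (cong (λ k → drop k v) (m+[n∸m]≡n (<⇒≤ i<j))))))) =
  inj₂ (take i v , u , t ,
    trans (sym (List.take++drop≡id i v)) (cong (take i v ++_) s≡) ,
    ≤-<-trans (≤-trans (≤-reflexive (List.length-take i v)) (m⊓n≤m i _)) (<-trans i<j j<n) ,
    |u|<n)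

-- Decomposition of a word into windows and runs

-- The two ways in which repetitions of u stop: close to the end of the word, where only the length
-- of the remainder is recorded, or at a letter x where the period would continue with y.
data Run {l} (u : List (Fin l)) : List (Fin l) → Set where
  ends   : ∀ k {r} → length r ≤ length u → Run u (pow u k ++ r)
  breaks : ∀ k {s y t x r} → u ≡ s ++ y ∷ t → y ≢ x → Run u (pow u k ++ s ++ x ∷ r)

extend-Run : ∀ {u r : List (Fin l)} → Run u r → Run u (u ++ r)
extend-Run {u = u} (ends k le) =
  subst (Run u) (List.++-assoc u (pow u k) _) (ends (suc k) le)
extend-Run {u = u} (breaks k u≡ y≢x) =
  subst (Run u) (List.++-assoc u (pow u k) _) (breaks (suc k) u≡ y≢x)

data Comparison {l} (u r : List (Fin l)) : Set where
  prefix : ∀ {r′} → r ≡ u ++ r′ → Comparison u r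
  short  : length r ≤ length u → Comparison u r
  differ : ∀ s {y x t r′} → u ≡ s ++ y ∷ t → r ≡ s ++ x ∷ r′ → y ≢ x → Comparison u r

comparison : (u r : List (Fin l)) → Comparison u r
comparison []      r       = prefix refl
comparison (y ∷ u) []      = short z≤n
comparison (y ∷ u) (x ∷ r) with y Fin.≟ x
... | no y≢x = differ [] refl refl y≢x
... | yes refl with comparison u r
...   | prefix r≡          = prefix (cong (y ∷_) r≡)
...   | short le           = short (s≤s le)
...   | differ s u≡ r≡ z≢x = differ (y ∷ s) (cong (y ∷_) u≡) (cong (y ∷_) r≡) z≢x

maximal-Run : ∀ (u : Word (Fin l)) r → Acc _<_ (length r) → Run (toList u) r
maximal-Run u r (acc rs) with comparison (toList u) r
... | short le              = ends 0 le
... | differ s u≡ refl y≢x  = breaks 0 u≡ y≢x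
... | prefix {r′} refl      = extend-Run (maximal-Run u r′
  (rs (s≤s (≤-trans (m≤n+m _ (length (List⁺.tail u)))
                    (≤-reflexive (sym (List.length-++ (List⁺.tail u))))))))

-- The exponent is n however long the run is, so that there are only finitely many broken runs to
-- count.
data Broken (n : ℕ) {l} : List (Fin l) → Set where
  broken : ∀ {y u x} → suc (length u) < n → y ≢ x →
           Broken n (pow (y ∷ u) n ++ [ x ])

-- The suffixes uⁱx with i < n are pairwise comparable because x differs from the
-- first letter of u.
Broken⇒Rich : ∀ {n} {v : List (Fin l)} → Broken n v → Rich n v
Broken⇒Rich {l} {n} (broken {y} {u} {x} _ y≢x) =
  applyUpTo F n , List.length-applyUpTo F n ,
  AllPairs.applyUpTo⁺₁ F n (λ {i} {j} i<j _ → comparable {i} {j} i<j) ,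
  All.applyUpTo⁺₁ F n (λ {i} i<n → nonempty i , factor i<n)
  where
  F : ℕ → List (Fin l)
  F i = pow (y ∷ u) i ++ [ x ]
  comparable : ∀ {i j} → i < j → F i # F j
  comparable {zero}  {suc j} _         = heads-# (y≢x ∘ sym)
  comparable {suc i} {suc j} (s≤s i<j) = subst₂ _#_
    (sym (List.++-assoc (y ∷ u) (pow (y ∷ u) i) _))
    (sym (List.++-assoc (y ∷ u) (pow (y ∷ u) j) _))
    (#-++ˡ (y ∷ u) (comparable {i} {j} i<j))
  nonempty : ∀ i → 0 < length (F i)
  nonempty zero    = z<s
  nonempty (suc i) = z<s
  factor : ∀ {i} → i < n → Factor-of (F n) (F i)
  factor {i} i<n = pow (y ∷ u) (n ∸ i) , [] , (begin
    pow (y ∷ u) n ++ [ x ]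
      ≡⟨ cong (λ k → pow (y ∷ u) k ++ [ x ]) (m∸n+n≡m (<⇒≤ i<n)) ⟨
    pow (y ∷ u) (n ∸ i + i) ++ [ x ]
      ≡⟨ cong (_++ [ x ]) (pow-+ (y ∷ u) (n ∸ i) i) ⟩
    (pow (y ∷ u) (n ∸ i) ++ pow (y ∷ u) i) ++ [ x ]
      ≡⟨ List.++-assoc (pow (y ∷ u) (n ∸ i)) _ _ ⟩
    pow (y ∷ u) (n ∸ i) ++ F i
      ≡⟨ cong (pow (y ∷ u) (n ∸ i) ++_) (List.++-identityʳ (F i)) ⟨
    pow (y ∷ u) (n ∸ i) ++ F i ++ [] ∎)
    where open ≡-Reasoning

-- h bounds the number of powers, s the total length of the gaps between them.
data Alternating (n : ℕ) {l} : ℕ → ℕ → List (Fin l) → Set where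
  gap   : ∀ {h s w} → length w ≤ s → Alternating n h s w
  power : ∀ {h s s′ w} g (u : Word (Fin l)) k → List⁺.length u < n →
          length g + s′ ≤ s → Alternating n h s′ w →
          Alternating n (suc h) s (g ++ pow (toList u) (suc k) ++ w)

++-Alternating : ∀ {n h s s′} (v : List (Fin l)) {w} → length v + s ≤ s′ →
                 Alternating n h s w → Alternating n h s′ (v ++ w)
++-Alternating v le (gap le′) =
  gap (≤-trans (≤-reflexive (List.length-++ v)) (≤-trans (+-monoʳ-≤ (length v) le′) le))
++-Alternating {n = n} {s = s} {s′} v le (power {h} {s′ = s″} g u k |u|<n le′ p) =
  subst (Alternating n _ _) (List.++-assoc v g _) (power (v ++ g) u k |u|<n le″ p)
  where
  open ≤-Reasoning
  le″ : length (v ++ g) + s″ ≤ s′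
  le″ = begin
    length (v ++ g) + s″         ≡⟨ cong (_+ s″) (List.length-++ v) ⟩
    (length v + length g) + s″   ≡⟨ +-assoc (length v) (length g) s″ ⟩
    length v + (length g + s″)   ≤⟨ +-monoʳ-≤ (length v) le′ ⟩
    length v + s                 ≤⟨ le ⟩
    s′                           ∎

Alternating-mono : ∀ {n h h′ s s′} {w : List (Fin l)} → h ≤ h′ → s ≤ s′ →
                   Alternating n h s w → Alternating n h′ s′ w
Alternating-mono h≤ s≤ (gap le)              = gap (≤-trans le s≤)
Alternating-mono (s≤s h≤) s≤ (power g u k |u|<n le p) =
  power g u k |u|<n (≤-trans le s≤) (Alternating-mono h≤ ≤-refl p)

-- One step adds to the gaps either a window of length n + n² or at most 2n letters.
step : ℕ → ℕ
step n = n + (n + n * n)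

-- Windows and runs are listed separately because the pigeonhole principle is applied to each kind
-- by itself. Both bounds in `alternating` have an additional 1 to account for the end of the word.
record Parse (n : ℕ) (w : List (Fin l)) : Set where
  field
    windows runs  : List (List (Fin l))
    w⊇windows     : w Contains windows
    w⊇runs        : w Contains runs
    windows-rich  : All (λ v → length v ≡ n + n * n × Rich n v) windows
    runs-broken   : All (Broken n) runs
    alternating   : Alternating n (suc (length runs))
                      (suc (length windows + length runs) * step n) w

gap-Parse : ∀ {n} {w : List (Fin l)} → length w ≤ step n → Parse n w
gap-Parse le = record
  { windows = [] ; runs = [] ; w⊇windows = [] ; w⊇runs = []
  ; windows-rich = [] ; runs-broken = []
  ; alternating = gap (≤-trans le (≤-reflexive (sym (+-identityʳ _)))) }

window-Parse : ∀ {n} {v w : List (Fin l)} → length v ≡ n + n * n → Rich n v →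
               Parse n w → Parse n (v ++ w)
window-Parse {n = n} {v} |v|≡ rich P = record
  { windows      = v ∷ windows
  ; runs         = runs
  ; w⊇windows    = split [] refl w⊇windows
  ; w⊇runs       = ++-Contains v w⊇runs
  ; windows-rich = (|v|≡ , rich) ∷ windows-rich
  ; runs-broken  = runs-broken
  ; alternating  = ++-Alternating v
      (+-monoˡ-≤ _ (≤-trans (≤-reflexive |v|≡) (m≤n+m _ n))) alternating
  }
  where open Parse P

-- The run that reaches the end of the word is not broken and so cannot be counted among `runs`; it
-- uses the one additional power.
final-run-Parse : ∀ {n} .{{_ : NonZero n}} g (u : Word (Fin l)) k {r} →
                  length g < n → List⁺.length u < n → length r ≤ List⁺.length u →
                  Parse n (g ++ pow (toList u) (n + k) ++ r)
final-run-Parse {n = suc n} g u k |g|<n |u|<n |r|≤ = record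
  { windows = [] ; runs = [] ; w⊇windows = [] ; w⊇runs = []
  ; windows-rich = [] ; runs-broken = []
  ; alternating = power g u (n + k) |u|<n
      (≤-trans (+-mono-≤ (<⇒≤ |g|<n) (≤-trans |r|≤ (<⇒≤ |u|<n)))
        (≤-trans (+-monoʳ-≤ (suc n) (m≤m+n (suc n) _))
                 (≤-reflexive (sym (+-identityʳ (step (suc n)))))))
      (gap ≤-refl)
  }

-- The whole run becomes one power. The letters of g and the breaking letter x go to the gaps;
-- together they number at most 2n, which `step n` covers.
run-Parse : ∀ {n} .{{_ : NonZero n}} g {y : Fin l} u k {x w} → length g < n + n →
            suc (length u) < n → y ≢ x → Parse n w →
            Parse n (g ++ pow (y ∷ u) (n + k) ++ x ∷ w)
run-Parse {n = n@(suc n′)} g {y} u k {x} {w} |g|< |u|<n y≢x P = record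
  { windows      = windows
  ; runs         = (pow (y ∷ u) n ++ [ x ]) ∷ runs
  ; w⊇windows    = ++-Contains g (++-Contains (pow (y ∷ u) (n + k))
                     (++-Contains [ x ] w⊇windows))
  -- Of the n + k periods the last n are listed, as they are adjacent to the breaking letter.
  ; w⊇runs       = split (g ++ pow (y ∷ u) k) contains w⊇runs
  ; windows-rich = windows-rich
  ; runs-broken  = broken |u|<n y≢x ∷ runs-broken
  ; alternating  = power g (y ∷ u) (n′ + k) |u|<n le
                     (++-Alternating [ x ] ≤-refl alternating)
  }
  where
  open Parse P
  W = length windows
  R = length runs
  contains : g ++ pow (y ∷ u) (n + k) ++ x ∷ w ≡
             (g ++ pow (y ∷ u) k) ++ (pow (y ∷ u) n ++ [ x ]) ++ w
  contains = begin
    g ++ pow (y ∷ u) (n + k) ++ x ∷ w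
      ≡⟨ cong (λ m → g ++ pow (y ∷ u) m ++ x ∷ w) (+-comm n k) ⟩
    g ++ pow (y ∷ u) (k + n) ++ x ∷ w
      ≡⟨ cong (λ z → g ++ z ++ x ∷ w) (pow-+ (y ∷ u) k n) ⟩
    g ++ (pow (y ∷ u) k ++ pow (y ∷ u) n) ++ x ∷ w
      ≡⟨ cong (g ++_) (List.++-assoc (pow (y ∷ u) k) _ _) ⟩
    g ++ pow (y ∷ u) k ++ pow (y ∷ u) n ++ x ∷ w
      ≡⟨ List.++-assoc g _ _ ⟨
    (g ++ pow (y ∷ u) k) ++ pow (y ∷ u) n ++ x ∷ w
      ≡⟨ cong ((g ++ pow (y ∷ u) k) ++_) (List.++-assoc (pow (y ∷ u) n) [ x ] w) ⟨
    (g ++ pow (y ∷ u) k) ++ (pow (y ∷ u) n ++ [ x ]) ++ w ∎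
    where open ≡-Reasoning
  le : length g + suc (suc (W + R) * step n) ≤ suc (W + suc R) * step n
  le = begin
    length g + suc (suc (W + R) * step n)   ≡⟨ +-suc (length g) _ ⟩
    suc (length g) + suc (W + R) * step n   ≤⟨ +-monoˡ-≤ _ |g|< ⟩
    (n + n) + suc (W + R) * step n
      ≤⟨ +-monoˡ-≤ _ (+-monoʳ-≤ n (m≤m+n n (n * n))) ⟩
    step n + suc (W + R) * step n           ≡⟨ cong (λ m → suc m * step n) (+-suc W R) ⟨
    suc (W + suc R) * step n                ∎
    where open ≤-Reasoning

-- If a run of period u = s y t breaks after a partial period s, then rotating the
-- period to y t s makes its first letter the one that was expected there.
rotate-run : ∀ (g s : List X) {y t x w} m k →
             g ++ pow (s ++ y ∷ t) m ++ pow (s ++ y ∷ t) k ++ s ++ x ∷ w ≡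
             (g ++ s) ++ pow (y ∷ t ++ s) (m + k) ++ x ∷ w
rotate-run g s {y} {t} {x} {w} m k = begin
  g ++ pow u m ++ pow u k ++ s ++ x ∷ w
    ≡⟨ cong (g ++_) (List.++-assoc (pow u m) (pow u k) _) ⟨
  g ++ (pow u m ++ pow u k) ++ s ++ x ∷ w
    ≡⟨ cong (λ z → g ++ z ++ s ++ x ∷ w) (pow-+ u m k) ⟨
  g ++ pow u (m + k) ++ s ++ x ∷ w
    ≡⟨ cong (g ++_) (List.++-assoc (pow u (m + k)) s _) ⟨
  g ++ (pow u (m + k) ++ s) ++ x ∷ w
    ≡⟨ cong (λ z → g ++ z ++ x ∷ w) (pow-rotate s (y ∷ t) (m + k)) ⟩
  g ++ (s ++ pow (y ∷ t ++ s) (m + k)) ++ x ∷ w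
    ≡⟨ cong (g ++_) (List.++-assoc s _ _) ⟩
  g ++ s ++ pow (y ∷ t ++ s) (m + k) ++ x ∷ w
    ≡⟨ List.++-assoc g s _ ⟨
  (g ++ s) ++ pow (y ∷ t ++ s) (m + k) ++ x ∷ w ∎
  where
  open ≡-Reasoning
  u = s ++ y ∷ t

parse-run : ∀ {n} .{{_ : NonZero n}} (g : List (Fin l)) {u r} →
            length g < n → List⁺.length u < n → Run (toList u) r →
            (∀ w → length w < length r → Parse n w) →
            Parse n (g ++ pow (toList u) n ++ r)
parse-run {n = n} g {u} |g|<n |u|<n (ends k {r} le) _ =
  subst (Parse n) eq (final-run-Parse g u k |g|<n |u|<n le)
  where
  eq : g ++ pow (toList u) (n + k) ++ r ≡ g ++ pow (toList u) n ++ pow (toList u) k ++ r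
  eq = cong (g ++_) (trans (cong (_++ r) (pow-+ (toList u) n k))
                           (List.++-assoc (pow (toList u) n) _ r))
parse-run {n = n} g {u} |g|<n |u|<n (breaks k {s} {y} {t} {x} {r} u≡ y≢x) rec =
  -- The partial period s is moved in front of the run and joins g, which turns the bound n on the
  -- letters before the run into 2n.
  subst (Parse n) eq (run-Parse (g ++ s) (t ++ s) k
    (subst (_< n + n) (sym (List.length-++ g)) (+-mono-<-≤ |g|<n |s|≤n))
    |yts|<n y≢x (rec r |r|<))
  where
  |u|≡ : List⁺.length u ≡ length s + suc (length t)
  |u|≡ = trans (cong length u≡) (List.length-++ s)
  |s|≤n : length s ≤ n
  |s|≤n = ≤-trans (m≤m+n _ _) (≤-trans (≤-reflexive (sym |u|≡)) (<⇒≤ |u|<n))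
  |yts|<n : suc (length (t ++ s)) < n
  |yts|<n = subst (_< n) (trans |u|≡ (trans (+-comm (length s) _)
              (cong suc (sym (List.length-++ t))))) |u|<n
  |r|< : length r < length (pow (toList u) k ++ s ++ x ∷ r)
  |r|< = ≤-trans (m≤n+m _ (length s)) (≤-trans (≤-reflexive (sym (List.length-++ s)))
           (≤-trans (m≤n+m _ (length (pow (toList u) k)))
             (≤-reflexive (sym (List.length-++ (pow (toList u) k))))))
  eq : (g ++ s) ++ pow (y ∷ t ++ s) (n + k) ++ x ∷ r ≡
       g ++ pow (toList u) n ++ pow (toList u) k ++ s ++ x ∷ r
  eq = trans (sym (rotate-run g s n k))
             (cong (λ z → g ++ pow z n ++ pow z k ++ s ++ x ∷ r) (sym u≡))

-- A greedy reading from left to right. If the next n + n² letters form a rich window, it is cut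
-- off. Otherwise a power uⁿ starts at one of its first n positions, and its run is followed,
-- possibly beyond the window, to its break or to the end of the word.
parse : ∀ n .{{_ : NonZero n}} (w : List (Fin l)) → Acc _<_ (length w) → Parse n w
parse n w (acc rs) with length w ≤? n + n * n
... | yes le = gap-Parse (≤-trans le (m≤n+m _ n))
... | no  gt
  with take t w | drop t w | List.take++drop≡id t w |
       trans (List.length-take t w) (m≤n⇒m⊓n≡m (<⇒≤ (≰⇒> gt)))
  where t = n + n * n
...   | v | w′ | refl | |v|≡ with window n v |v|≡
...     | inj₁ rich = window-Parse |v|≡ rich (parse n w′ (rs shorter))
  where
  shorter : length w′ < length (v ++ w′)
  shorter = subst (length w′ <_) (sym (List.length-++ v))
    (m<n+m _ (subst (0 <_) (sym |v|≡) (≤-trans (>-nonZero⁻¹ n) (m≤m+n n (n * n)))))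
...     | inj₂ (g , u , r , refl , |g|<n , |u|<n) =
  subst (Parse n) assoc (parse-run g |g|<n |u|<n
    (maximal-Run u (r ++ w′) (<-wellFounded _))
    (λ w″ lt → parse n w″ (rs (≤-trans lt shorter))))
  where
  U = pow (toList u) n
  assoc : g ++ U ++ r ++ w′ ≡ (g ++ U ++ r) ++ w′
  assoc = sym (trans (List.++-assoc g (U ++ r) w′) (cong (g ++_) (List.++-assoc U r w′)))
  shorter : length (r ++ w′) ≤ length ((g ++ U ++ r) ++ w′)
  shorter = begin
    length (r ++ w′)                  ≤⟨ m≤n+m _ (length U) ⟩
    length U + length (r ++ w′)       ≡⟨ List.length-++ U ⟨
    length (U ++ r ++ w′)             ≤⟨ m≤n+m _ (length g) ⟩
    length g + length (U ++ r ++ w′)  ≡⟨ List.length-++ g ⟨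
    length (g ++ U ++ r ++ w′)        ≡⟨ cong length assoc ⟩
    length ((g ++ U ++ r) ++ w′)      ∎
    where open ≤-Reasoning

-- Counting words and broken runs; the pigeonhole principle

length-cartesianProductWith : ∀ {b c} {Y : Set b} {Z : Set c} (f : X → Y → Z) xs ys →
  length (cartesianProductWith f xs ys) ≡ length xs * length ys
length-cartesianProductWith f []       ys = refl
length-cartesianProductWith f (x ∷ xs) ys = trans (List.length-++ (map (f x) ys))
  (cong₂ _+_ (List.length-map (f x) ys) (length-cartesianProductWith f xs ys))

wordsUpTo : ∀ l → ℕ → List (List (Fin l))
wordsUpTo l zero    = [ [] ]
wordsUpTo l (suc k) = [] ∷ cartesianProductWith _∷_ (allFin l) (wordsUpTo l k)

∈-wordsUpTo : ∀ {k} (w : List (Fin l)) → length w ≤ k → w ∈ wordsUpTo l k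
∈-wordsUpTo {k = zero}  []      _        = here refl
∈-wordsUpTo {k = suc k} []      _        = here refl
∈-wordsUpTo {k = suc k} (x ∷ w) (s≤s le) =
  there (∈-cartesianProductWith⁺ _∷_ (∈-allFin x) (∈-wordsUpTo w le))

length-allFin : ∀ l → length (allFin l) ≡ l
length-allFin l = List.length-tabulate {n = l} (λ i → i)

length-wordsUpTo : ∀ l k → length (wordsUpTo l k) ≤ (l + 1) ^ k
length-wordsUpTo l zero    = ≤-refl
length-wordsUpTo l (suc k) = begin
  suc (length (cartesianProductWith _∷_ (allFin l) (wordsUpTo l k)))
    ≡⟨ cong suc (length-cartesianProductWith _∷_ (allFin l) (wordsUpTo l k)) ⟩
  suc (length (allFin l) * length (wordsUpTo l k))
    ≡⟨ cong (λ m → suc (m * length (wordsUpTo l k))) (length-allFin l) ⟩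
  suc (l * length (wordsUpTo l k))
    ≤⟨ s≤s (*-monoʳ-≤ l (length-wordsUpTo l k)) ⟩
  1 + l * (l + 1) ^ k
    ≤⟨ +-monoˡ-≤ _ (m^n>0 (l + 1) {{>-nonZero (m≤n+m 1 l)}} k) ⟩
  suc l * (l + 1) ^ k
    ≡⟨ cong (_* (l + 1) ^ k) (+-comm 1 l) ⟩
  (l + 1) * (l + 1) ^ k ∎
  where open ≤-Reasoning

-- An overcount that is easy to bound: u may have any length up to n, and x may be any letter. The
-- resulting (l + 1)ⁿ l is the main factor of the height.
brokenRuns : ∀ l → ℕ → List (List (Fin l))
brokenRuns l n = cartesianProductWith (λ u x → pow u n ++ [ x ]) (wordsUpTo l n) (allFin l)

∈-brokenRuns : ∀ {n} {v : List (Fin l)} → Broken n v → v ∈ brokenRuns l n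
∈-brokenRuns (broken {x = x} |u|<n _) =
  ∈-cartesianProductWith⁺ _ (∈-wordsUpTo _ (<⇒≤ |u|<n)) (∈-allFin x)

length-brokenRuns : ∀ l n → length (brokenRuns l n) ≤ (l + 1) ^ n * l
length-brokenRuns l n = begin
  length (brokenRuns l n)
    ≡⟨ length-cartesianProductWith _ (wordsUpTo l n) (allFin l) ⟩
  length (wordsUpTo l n) * length (allFin l)
    ≡⟨ cong (length (wordsUpTo l n) *_) (length-allFin l) ⟩
  length (wordsUpTo l n) * l
    ≤⟨ *-monoˡ-≤ l (length-wordsUpTo l n) ⟩
  (l + 1) ^ n * l ∎
  where open ≤-Reasoning

length-filter-¬ : {P : Pred X p} (P? : Decidable P) → ∀ xs →
                  length (filter P? xs) + length (filter (¬? ∘ P?) xs) ≡ length xs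
length-filter-¬ P? []       = refl
length-filter-¬ P? (x ∷ xs) with P? x
... | yes _ = cong suc (length-filter-¬ P? xs)
... | no  _ = trans (+-suc _ _) (cong suc (length-filter-¬ P? xs))

-- Induction on the admissible values: either k occurs more than n times, or deleting its at most n
-- occurrences leaves a list over the remaining values. A frequent value is an entry of `xs` and so
-- inherits Q, which carries richness over to it.
pigeonhole : {Q : Pred X p} (_≟_ : DecidableEquality X) (n : ℕ) (ks xs : List X) →
             All (_∈ ks) xs → All Q xs →
             length xs ≤ length ks * n ⊎ ∃[ k ] (Q k × n < length (filter (_≟ k) xs))
pigeonhole _≟_ n []       []       _            _  = inj₁ z≤n
pigeonhole _≟_ n []       (_ ∷ _)  (() ∷ _)     _
pigeonhole _≟_ n (k ∷ ks) xs       xs∈          Qxs with n <? length (filter (_≟ k) xs)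
... | yes n< = inj₂ (k , Qk (filter (_≟ k) xs) (All.all-filter (_≟ k) xs)
                           (All.filter⁺ (_≟ k) Qxs) n< , n<)
  where
  Qk : ∀ {q n} {Q : Pred _ q} ys → All (_≡ k) ys → All Q ys → n < length ys → Q k
  Qk (_ ∷ _) (refl ∷ _) (q ∷ _) _ = q
... | no n≮
  with pigeonhole _≟_ n ks (filter (¬? ∘ (_≟ k)) xs)
         (All.zipWith (λ { (x≢k , here x≡k) → contradiction x≡k x≢k ; (_ , there x∈) → x∈ })
           (All.all-filter (¬? ∘ (_≟ k)) xs , All.filter⁺ (¬? ∘ (_≟ k)) xs∈))
         (All.filter⁺ (¬? ∘ (_≟ k)) Qxs)
...   | inj₁ le = inj₁ (subst (_≤ n + length ks * n) (length-filter-¬ (_≟ k) xs)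
                              (+-mono-≤ (≮⇒≥ n≮) le))
...   | inj₂ (k′ , Qk′ , n<) = inj₂ (k′ , Qk′ , ≤-trans n< (sub xs))
  where
  sub : ∀ xs → length (filter (_≟ k′) (filter (¬? ∘ (_≟ k)) xs)) ≤ length (filter (_≟ k′) xs)
  sub []       = z≤n
  sub (x ∷ xs) with x ≟ k
  ... | yes _ with x ≟ k′
  ...   | yes _ = m≤n⇒m≤1+n (sub xs)
  ...   | no  _ = sub xs
  sub (x ∷ xs) | no _ with x ≟ k′
  ...   | yes _ = s≤s (sub xs)
  ...   | no  _ = sub xs

-- Every word is divisible or alternates between few powers and short gaps

few-or-Divisible : ∀ {n} {w : List (Fin l)} ks cs → w Contains cs → All (_∈ ks) cs →
                   All (Rich n) cs → Divisible n w ⊎ length cs ≤ length ks * n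
few-or-Divisible {n = n} ks cs p cs∈ rich with pigeonhole _≟ʷ_ n ks cs cs∈ rich
... | inj₁ le               = inj₂ le
... | inj₂ (v , rich-v , n<) = inj₁ (rich-copies⇒Divisible rich-v
        (Contains-filter (_≟ʷ v) p) (All.all-filter (_≟ʷ v) cs) (<⇒≤ n<))

-- The number of windows enters only here, and hence only the choice of the finite set `D`; the
-- number of powers is bounded through the broken runs alone.
gapLength : ℕ → ℕ → ℕ
gapLength l n = suc (length (wordsUpTo l (n + n * n)) * n + length (brokenRuns l n) * n) * step n

dichotomy : ∀ n .{{_ : NonZero n}} (w : List (Fin l)) →
            Divisible n w ⊎
            Alternating n (suc (length (brokenRuns l n) * n)) (gapLength l n) w
dichotomy {l} n w = combine
  (few-or-Divisible (brokenRuns l n) runs w⊇runs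
    (All.map ∈-brokenRuns runs-broken) (All.map Broken⇒Rich runs-broken))
  (few-or-Divisible (wordsUpTo l (n + n * n)) windows w⊇windows
    (All.map (λ (|v|≡ , _) → ∈-wordsUpTo _ (≤-reflexive |v|≡)) windows-rich)
    (All.map proj₂ windows-rich))
  where
  open Parse (parse n w (<-wellFounded _))
  combine : Divisible n w ⊎ length runs ≤ length (brokenRuns l n) * n →
            Divisible n w ⊎ length windows ≤ length (wordsUpTo l (n + n * n)) * n →
            Divisible n w ⊎
            Alternating n (suc (length (brokenRuns l n) * n)) (gapLength l n) w
  combine (inj₁ div)   _               = inj₁ div
  combine (inj₂ _)     (inj₁ div)      = inj₁ div
  combine (inj₂ runs≤) (inj₂ windows≤) = inj₂ (Alternating-mono (s≤s runs≤)
    (*-monoˡ-≤ (step n) (s≤s (+-mono-≤ windows≤ runs≤))) alternating)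

-- Nonempty words as lists

toList-injective : ∀ {u v : Word X} → toList u ≡ toList v → u ≡ v
toList-injective refl = refl

toList-++⁺ : ∀ (s : List X) (w : Word X) → toList (s ++⁺ w) ≡ s ++ toList w
toList-++⁺ []      w = refl
toList-++⁺ (x ∷ s) w = cong (x ∷_) (toList-++⁺ s w)

-- Permutations of a descending sequence

↭-of-length : ∀ {is vs : List X} → Unique is → All (_∈ vs) is →
              length vs ≤ length is → vs ↭ is
↭-of-length {vs = []}    []       []       _ = ↭-refl
↭-of-length {is = i ∷ is} (i∉ ∷ is!) (i∈ ∷ is∈) le
  with as , bs , refl ← ∈-∃++ i∈ =
  ↭-trans (Perm.shift i as bs) (prep i (↭-of-length is! (All.zipWith other (i∉ , is∈))
    (s≤s⁻¹ (≤-trans (≤-reflexive (sym (Perm.↭-length (Perm.shift i as bs)))) le))))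
  where
  other : ∀ {j} → i ≢ j × j ∈ as ++ [ i ] ++ bs → j ∈ as ++ bs
  other (i≢j , j∈) with Perm.∈-resp-↭ (Perm.shift i as bs) j∈
  ... | here j≡i = contradiction (sym j≡i) i≢j
  ... | there j∈ = j∈

-- At the first place where the orders differ, the original sequence still has
-- its largest remaining word.
permuted-≻ : DecidableEquality Z → (U : Z → List (Fin l)) → ∀ {vs is} → vs ↭ is →
             vs ≢ is → AllPairs (_≻_ on U) is → concat (map U is) ≻ concat (map U vs)
permuted-≻ _≟_ U {vs} {[]} σ vs≢ _ = contradiction (Perm.↭-empty-inv σ) vs≢
permuted-≻ _≟_ U {[]} {i ∷ is} σ vs≢ _ = contradiction (Perm.↭-length σ) λ ()
permuted-≻ _≟_ U {v ∷ vs} {i ∷ is} σ vs≢ (i≻ ∷ is≻) with v ≟ i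
... | yes refl = ≻-++ˡ (U v) (permuted-≻ _≟_ U (Perm.drop-∷ σ) (vs≢ ∘ cong (v ∷_)) is≻)
... | no v≢i with Perm.∈-resp-↭ σ (here refl)
...   | here v≡i  = contradiction v≡i v≢i
...   | there v∈is = ≻-++ʳ (All.lookup i≻ v∈is) (concat (map U is)) (concat (map U vs))

permuted-length : (U : Z → List X) → ∀ {vs is} → vs ↭ is →
                  length (concat (map U vs)) ≡ length (concat (map U is))
permuted-length U {vs} {is} σ = begin
  length (concat (map U vs))        ≡⟨ length-concat (map U vs) ⟩
  sum (map length (map U vs))       ≡⟨ sum-↭ (Perm.map⁺ length (Perm.map⁺ U σ)) ⟩
  sum (map length (map U is))       ≡⟨ length-concat (map U is) ⟨
  length (concat (map U is))        ∎
  where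
  open ≡-Reasoning
  length-concat : ∀ (xss : List (List _)) → length (concat xss) ≡ sum (map length xss)
  length-concat []         = refl
  length-concat (xs ∷ xss) = trans (List.length-++ xs) (cong (length xs +_) (length-concat xss))

-- Formal expansion of products of sums

-- The words obtained by replacing each letter i of a monomial by the formal sum of `pos i` and
-- multiplying out.
expand : (ℕ → List Z) → ℕ → List ℕ → List (Word Z)
expand pos x []       = map List⁺.[_] (pos x)
expand pos x (y ∷ ys) = cartesianProductWith _∷⁺_ (pos x) (expand pos y ys)

module _ {pos : ℕ → List Z} where

  -- Different choices of summands give different words. The identity word thus arises only once
  -- from the leading monomial and keeps the coefficient 1.
  Unique-expand : (∀ i → Unique (pos i)) → ∀ x xs → Unique (expand pos x xs)
  Unique-expand pos! x []       = Unique.map⁺ (λ { refl → refl }) (pos! x)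
  Unique-expand pos! x (y ∷ ys) =
    Unique.cartesianProductWith⁺ _∷⁺_ (λ { {y = _ ∷ _} {z = _ ∷ _} refl → refl , refl })
      (pos! x) (Unique-expand pos! y ys)

module _ {pos : ℕ → List Z} {letter : Z → ℕ} where

  -- Applying `letter` recovers the monomial from which a word was expanded, so that no word comes
  -- from two different monomials.
  ∈-expand⁻ : (∀ {i j} → j ∈ pos i → letter j ≡ i) →
              ∀ x xs {v} → v ∈ expand pos x xs → map letter (toList v) ≡ x ∷ xs
  ∈-expand⁻ pos⁻ x [] v∈ with j , j∈ , refl ← ∈-map⁻ List⁺.[_] v∈ =
    cong [_] (pos⁻ j∈)
  ∈-expand⁻ pos⁻ x (y ∷ ys) v∈
    with j , v′ , j∈ , v′∈ , refl ← ∈-cartesianProductWith⁻ _∷⁺_ (pos x) (expand pos y ys) v∈ =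
    cong₂ _∷_ (pos⁻ j∈) (∈-expand⁻ pos⁻ y ys v′∈)

  ∈-expand⁺ : (∀ j → j ∈ pos (letter j)) → ∀ x xs (v : Word Z) →
              map letter (toList v) ≡ x ∷ xs → v ∈ expand pos x xs
  ∈-expand⁺ pos⁺ x []       (j ∷ [])     refl = ∈-map⁺ List⁺.[_] (pos⁺ j)
  ∈-expand⁺ pos⁺ x (y ∷ ys) (j ∷ k ∷ v) refl =
    ∈-cartesianProductWith⁺ _∷⁺_ (pos⁺ j) (∈-expand⁺ pos⁺ y ys (k ∷ v) refl)

-- The places at which i occurs in a word whose j-th letter is `letter j`. Replacing i by the sum of
-- the variables at these places separates the repeated letters of the word.
positions : ∀ {n} → (Fin n → ℕ) → ℕ → List (Fin n)
positions {n} letter i = filter (λ j → letter j ℕ.≟ i) (allFin n)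

module _ {n} (letter : Fin n → ℕ) where

  ∈-positions⁻ : ∀ {i j} → j ∈ positions letter i → letter j ≡ i
  ∈-positions⁻ {i} j∈ = proj₂ (∈-filter⁻ (λ j → letter j ℕ.≟ i) {xs = allFin n} j∈)

  ∈-positions⁺ : ∀ j → j ∈ positions letter (letter j)
  ∈-positions⁺ j = ∈-filter⁺ (λ k → letter k ℕ.≟ letter j) (∈-allFin j) refl

  positions-Unique : ∀ i → Unique (positions letter i)
  positions-Unique i = Unique.filter⁺ (λ j → letter j ℕ.≟ i) (Unique.allFin⁺ n)

map-lookup-allFin : (xs : List X) → map (lookup xs) (allFin (length xs)) ≡ xs
map-lookup-allFin xs = trans (List.map-tabulate (λ i → i) (lookup xs)) (List.tabulate-lookup xs)

Unique-split : ∀ {x : X} {xs} → Unique xs → x ∈ xs →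
               ∃[ as ] ∃[ bs ] (xs ≡ as ++ x ∷ bs × All (x ≢_) as × All (x ≢_) bs)
Unique-split (x∉ ∷ _)   (here refl) = [] , _ , refl , [] , x∉
Unique-split (y∉ ∷ xs!) (there x∈)
  with as , bs , refl , as≢ , bs≢ ← Unique-split xs! x∈ =
  _ ∷ as , bs , refl , (All.lookup y∉ x∈ ∘ sym) ∷ as≢ , bs≢

filter-map-split : {Y : Set b} {P : Pred Y p} (P? : Decidable P) (f : X → Y) →
                   ∀ {x} → P (f x) → ∀ as bs rest →
                   filter P? (map f (as ++ x ∷ bs) ++ rest) ≡
                   filter P? (map f as) ++ f x ∷ (filter P? (map f bs) ++ filter P? rest)
filter-map-split P? f {x} Pfx as bs rest = begin
  filter P? (map f (as ++ x ∷ bs) ++ rest)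
    ≡⟨ List.filter-++ P? (map f (as ++ x ∷ bs)) rest ⟩
  filter P? (map f (as ++ x ∷ bs)) ++ filter P? rest
    ≡⟨ cong (λ z → filter P? z ++ filter P? rest) (List.map-++ f as (x ∷ bs)) ⟩
  filter P? (map f as ++ f x ∷ map f bs) ++ filter P? rest
    ≡⟨ cong (_++ filter P? rest) (List.filter-++ P? (map f as) _) ⟩
  (filter P? (map f as) ++ filter P? (f x ∷ map f bs)) ++ filter P? rest
    ≡⟨ cong (λ z → (filter P? (map f as) ++ z) ++ filter P? rest) (List.filter-accept P? Pfx) ⟩
  (filter P? (map f as) ++ f x ∷ filter P? (map f bs)) ++ filter P? rest
    ≡⟨ List.++-assoc (filter P? (map f as)) _ _ ⟩
  filter P? (map f as) ++ f x ∷ (filter P? (map f bs) ++ filter P? rest) ∎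
  where open ≡-Reasoning

filter-× : {P : Pred X p} {Q : Pred X q} {S : Pred X a}
           (P? : Decidable P) (Q? : Decidable Q) (S? : Decidable S) →
           (∀ {x} → P x → Q x → S x) → (∀ {x} → S x → P x × Q x) →
           ∀ xs → filter Q? (filter P? xs) ≡ filter S? xs
filter-× P? Q? S? pair unpair []       = refl
filter-× P? Q? S? pair unpair (x ∷ xs) with P? x
... | no ¬p = trans (filter-× P? Q? S? pair unpair xs)
                    (sym (List.filter-reject S? (¬p ∘ proj₁ ∘ unpair)))
... | yes p with Q? x
...   | yes q = trans (cong (x ∷_) (filter-× P? Q? S? pair unpair xs))
                      (sym (List.filter-accept S? (pair p q)))
...   | no ¬q = trans (filter-× P? Q? S? pair unpair xs)
                      (sym (List.filter-reject S? (¬q ∘ proj₂ ∘ unpair)))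

module _ {R : CommutativeRing c ℓ} (A : AssociativeAlgebra R m ℓm) where
  open CommutativeRing R using (Carrier; 0#; 1#; _≈_; -_) renaming (_+_ to _+ᴿ_)
  module R = CommutativeRing R
  open AssociativeAlgebra A
  module A = IsRingWithoutOne isRingWithoutOne
  open CommutativeSemigroupProperties
    (CommutativeMonoid.commutativeSemigroup +ᴹ-commutativeMonoid) using (x∙yz≈y∙xz)
  open SetoidReasoning ≈ᴹ-setoid

  -- Linear spans

  Span-bind : {P : Pred Carrierᴹ p} {Q : Pred Carrierᴹ q} →
              (∀ {x} → P x → Span A Q x) → ∀ {x} → Span A P x → Span A Q x
  Span-bind h (element px) = h px
  Span-bind h zero         = zero
  Span-bind h (add s t)    = add (Span-bind h s) (Span-bind h t)
  Span-bind h (scale r s)  = scale r (Span-bind h s)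
  Span-bind h (resp eq s)  = resp eq (Span-bind h s)

  record Linear (φ : Carrierᴹ → Carrierᴹ) : Set (c Level.⊔ m Level.⊔ ℓm) where
    field
      φ-cong : ∀ {x y} → x ≈ᴹ y → φ x ≈ᴹ φ y
      φ-+    : ∀ x y → φ (x +ᴹ y) ≈ᴹ φ x +ᴹ φ y
      φ-*ₗ   : ∀ r x → φ (r *ₗ x) ≈ᴹ r *ₗ φ x

    φ-0 : φ 0ᴹ ≈ᴹ 0ᴹ
    φ-0 = begin
      φ 0ᴹ          ≈⟨ φ-cong (*ₗ-zeroʳ 0#) ⟨
      φ (0# *ₗ 0ᴹ)  ≈⟨ φ-*ₗ 0# 0ᴹ ⟩
      0# *ₗ φ 0ᴹ    ≈⟨ *ₗ-zeroˡ _ ⟩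
      0ᴹ            ∎

    Span-map : {P : Pred Carrierᴹ p} {Q : Pred Carrierᴹ q} →
               (∀ {x} → P x → Span A Q (φ x)) → ∀ {x} → Span A P x → Span A Q (φ x)
    Span-map h (element px) = h px
    Span-map h zero         = resp (≈ᴹ-sym φ-0) zero
    Span-map h (add s t)    = resp (≈ᴹ-sym (φ-+ _ _)) (add (Span-map h s) (Span-map h t))
    Span-map h (scale r s)  = resp (≈ᴹ-sym (φ-*ₗ r _)) (scale r (Span-map h s))
    Span-map h (resp eq s)  = resp (φ-cong eq) (Span-map h s)

  ∙-linearˡ : ∀ y → Linear (y ∙_)
  ∙-linearˡ y = record
    { φ-cong = A.*-cong ≈ᴹ-refl ; φ-+ = A.distribˡ y ; φ-*ₗ = λ r x → ∙-*ₗ-comm r y x }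

  ∙-linearʳ : ∀ y → Linear (_∙ y)
  ∙-linearʳ y = record
    { φ-cong = λ eq → A.*-cong eq ≈ᴹ-refl ; φ-+ = A.distribʳ y ; φ-*ₗ = λ r x → *ₗ-∙-assoc r x y }

  Span-cancel : {P : Pred Carrierᴹ p} → ∀ {x s} → x +ᴹ s ≈ᴹ 0ᴹ → Span A P s → Span A P x
  Span-cancel {x = x} {s} x+s≈0 span = resp eq (scale (- 1#) span)
    where
    s-s≈0 : s +ᴹ (- 1#) *ₗ s ≈ᴹ 0ᴹ
    s-s≈0 = begin
      s +ᴹ (- 1#) *ₗ s            ≈⟨ +ᴹ-congʳ (*ₗ-identityˡ s) ⟨
      1# *ₗ s +ᴹ (- 1#) *ₗ s      ≈⟨ *ₗ-distribʳ s 1# (- 1#) ⟨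
      (1# +ᴿ - 1#) *ₗ s           ≈⟨ *ₗ-congʳ (R.-‿inverseʳ 1#) ⟩
      0# *ₗ s                     ≈⟨ *ₗ-zeroˡ s ⟩
      0ᴹ                          ∎
    eq : (- 1#) *ₗ s ≈ᴹ x
    eq = begin
      (- 1#) *ₗ s                 ≈⟨ +ᴹ-identityˡ _ ⟨
      0ᴹ +ᴹ (- 1#) *ₗ s           ≈⟨ +ᴹ-congʳ x+s≈0 ⟨
      (x +ᴹ s) +ᴹ (- 1#) *ₗ s     ≈⟨ +ᴹ-assoc x s _ ⟩
      x +ᴹ (s +ᴹ (- 1#) *ₗ s)     ≈⟨ +ᴹ-congˡ s-s≈0 ⟩
      x +ᴹ 0ᴹ                     ≈⟨ +ᴹ-identityʳ x ⟩
      x                           ∎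

  -- Values of words

  evalWord-cong : {ρ σ : X → Carrierᴹ} (w : Word X) → All (λ x → ρ x ≈ᴹ σ x) (toList w) →
                  evalWord A ρ w ≈ᴹ evalWord A σ w
  evalWord-cong (x ∷ [])     (eq ∷ [])  = eq
  evalWord-cong (x ∷ y ∷ w)  (eq ∷ eqs) = A.*-cong eq (evalWord-cong (y ∷ w) eqs)

  evalWord-⁺++⁺ : (ρ : X → Carrierᴹ) → ∀ x xs (w : Word X) →
                  evalWord A ρ ((x ∷ xs) ⁺++⁺ w) ≈ᴹ evalWord A ρ (x ∷ xs) ∙ evalWord A ρ w
  evalWord-⁺++⁺ ρ x []        w = ≈ᴹ-refl
  evalWord-⁺++⁺ ρ x (x′ ∷ xs) w = begin
    ρ x ∙ evalWord A ρ ((x′ ∷ xs) ⁺++⁺ w)             ≈⟨ A.*-cong ≈ᴹ-refl (evalWord-⁺++⁺ ρ x′ xs w) ⟩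
    ρ x ∙ (evalWord A ρ (x′ ∷ xs) ∙ evalWord A ρ w)   ≈⟨ A.*-assoc _ _ _ ⟨
    (ρ x ∙ evalWord A ρ (x′ ∷ xs)) ∙ evalWord A ρ w   ∎

  evalWord-concat : (ρ : X → Carrierᴹ) (U : Z → Word X) → ∀ v vs →
                    evalWord A (evalWord A ρ ∘ U) (v ∷ vs) ≈ᴹ
                    evalWord A ρ (List⁺.concat (List⁺.map U (v ∷ vs)))
  evalWord-concat ρ U v []        = ≈ᴹ-reflexive (cong (evalWord A ρ)
    (toList-injective (sym (List.++-identityʳ (toList (U v))))))
  evalWord-concat ρ U v (v′ ∷ vs) = begin
    evalWord A ρ (U v) ∙ evalWord A (evalWord A ρ ∘ U) (v′ ∷ vs)
      ≈⟨ A.*-cong ≈ᴹ-refl (evalWord-concat ρ U v′ vs) ⟩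
    evalWord A ρ (U v) ∙ evalWord A ρ (List⁺.concat (List⁺.map U (v′ ∷ vs)))
      ≈⟨ evalWord-⁺++⁺ ρ (List⁺.head (U v)) (List⁺.tail (U v)) (List⁺.concat (List⁺.map U (v′ ∷ vs))) ⟨
    evalWord A ρ (List⁺.concat (List⁺.map U (v ∷ v′ ∷ vs))) ∎

  -- Left multiplication by a possibly empty word. It is an operator because the algebra may lack a
  -- unit to serve as the value of the empty word.
  act : (X → Carrierᴹ) → List X → Carrierᴹ → Carrierᴹ
  act ρ []      x = x
  act ρ (a ∷ s) x = ρ a ∙ act ρ s x

  act-linear : (ρ : X → Carrierᴹ) (s : List X) → Linear (act ρ s)
  act-linear ρ []      = record
    { φ-cong = λ eq → eq ; φ-+ = λ _ _ → ≈ᴹ-refl ; φ-*ₗ = λ _ _ → ≈ᴹ-refl }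
  act-linear ρ (a ∷ s) = record
    { φ-cong = λ eq → L.φ-cong (S.φ-cong eq)
    ; φ-+    = λ x y → ≈ᴹ-trans (L.φ-cong (S.φ-+ x y)) (L.φ-+ _ _)
    ; φ-*ₗ   = λ r x → ≈ᴹ-trans (L.φ-cong (S.φ-*ₗ r x)) (L.φ-*ₗ r _)
    }
    where
    module L = Linear (∙-linearˡ (ρ a))
    module S = Linear (act-linear ρ s)

  evalWord-++⁺ : (ρ : X → Carrierᴹ) (s : List X) (w : Word X) →
                 evalWord A ρ (s ++⁺ w) ≈ᴹ act ρ s (evalWord A ρ w)
  evalWord-++⁺ ρ []      w = ≈ᴹ-refl
  evalWord-++⁺ ρ (a ∷ s) w = A.*-cong ≈ᴹ-refl (evalWord-++⁺ ρ s w)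

  -- Collecting the terms of a polynomial

  equal? : (u w : Word ℕ) → _
  equal? u w = List.≡-dec ℕ._≟_ (toList u) (toList w)

  differs? : (w : Word ℕ) → Decidable (λ (t : Carrier × Word ℕ) → toList (proj₂ t) ≢ toList w)
  differs? w (r , u) = ¬? (equal? u w)

  coefficient-same : ∀ r {u w} f → toList u ≡ toList w →
                     coefficient R ((r , u) ∷ f) w ≡ r +ᴿ coefficient R f w
  coefficient-same r {u} {w} f u≡w =
    cong (λ b → (if b then r else 0#) +ᴿ coefficient R f w) (dec-true (equal? u w) u≡w)

  coefficient-other : ∀ r {u w} f → toList u ≢ toList w →
                      coefficient R ((r , u) ∷ f) w ≈ coefficient R f w
  coefficient-other r {u} {w} f u≢w = R.trans
    (R.reflexive (cong (λ b → (if b then r else 0#) +ᴿ coefficient R f w)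
                       (dec-false (equal? u w) u≢w)))
    (R.+-identityˡ _)

  collect : ∀ f w ρ → evalPolynomial A ρ f ≈ᴹ
            coefficient R f w *ₗ evalWord A ρ w +ᴹ evalPolynomial A ρ (filter (differs? w) f)
  collect []            w ρ = ≈ᴹ-sym (≈ᴹ-trans (+ᴹ-identityʳ _) (*ₗ-zeroˡ _))
  collect ((r , u) ∷ f) w ρ with equal? u w
  ... | yes u≡w = begin
    r *ₗ evalWord A ρ u +ᴹ evalPolynomial A ρ f
      ≈⟨ +ᴹ-cong (≈ᴹ-reflexive (cong (λ v → r *ₗ evalWord A ρ v) (toList-injective u≡w)))
                 (collect f w ρ) ⟩
    r *ₗ z +ᴹ (k *ₗ z +ᴹ rest f)              ≈⟨ +ᴹ-assoc _ _ _ ⟨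
    (r *ₗ z +ᴹ k *ₗ z) +ᴹ rest f              ≈⟨ +ᴹ-congʳ (*ₗ-distribʳ z r k) ⟨
    (r +ᴿ k) *ₗ z +ᴹ rest f
      ≡⟨ cong₂ (λ k f → k *ₗ z +ᴹ evalPolynomial A ρ f) (coefficient-same r f u≡w)
           (List.filter-reject (differs? w) {x = r , u} {f} (λ ≢ → ≢ u≡w)) ⟨
    coefficient R ((r , u) ∷ f) w *ₗ z +ᴹ rest ((r , u) ∷ f) ∎
    where
    z    = evalWord A ρ w
    k    = coefficient R f w
    rest = λ f → evalPolynomial A ρ (filter (differs? w) f)
  ... | no u≢w = begin
    r *ₗ x +ᴹ evalPolynomial A ρ f            ≈⟨ +ᴹ-congˡ (collect f w ρ) ⟩
    r *ₗ x +ᴹ (k *ₗ z +ᴹ rest f)              ≈⟨ x∙yz≈y∙xz _ _ _ ⟩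
    k *ₗ z +ᴹ (r *ₗ x +ᴹ rest f)
      ≈⟨ +ᴹ-congʳ (*ₗ-congʳ (coefficient-other r f u≢w)) ⟨
    coefficient R ((r , u) ∷ f) w *ₗ z +ᴹ (r *ₗ x +ᴹ rest f)
      ≡⟨ cong (λ f′ → coefficient R ((r , u) ∷ f) w *ₗ z +ᴹ evalPolynomial A ρ f′)
           (List.filter-accept (differs? w) {x = r , u} {f} u≢w) ⟨
    coefficient R ((r , u) ∷ f) w *ₗ z +ᴹ rest ((r , u) ∷ f) ∎
    where
    x    = evalWord A ρ u
    z    = evalWord A ρ w
    k    = coefficient R f w
    rest = λ f → evalPolynomial A ρ (filter (differs? w) f)

  module _ {P : Pred (Word ℕ) p} (P? : Decidable P) where

    coefficient-filter⁺ : ∀ f {w} → P w →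
      coefficient R (filter (P? ∘ proj₂) f) w ≈ coefficient R f w
    coefficient-filter⁺ []            Pw = R.refl
    coefficient-filter⁺ ((r , u) ∷ f) {w} Pw with P? u
    ... | yes _  = R.+-congˡ (coefficient-filter⁺ f Pw)
    ... | no ¬Pu = R.trans (coefficient-filter⁺ f Pw) (R.sym
      (coefficient-other r {u} {w} f λ u≡w → ¬Pu (subst P (sym (toList-injective u≡w)) Pw)))

    coefficient-filter⁻ : ∀ f {w} → ¬ P w → coefficient R (filter (P? ∘ proj₂) f) w ≈ 0#
    coefficient-filter⁻ []            ¬Pw = R.refl
    coefficient-filter⁻ ((r , u) ∷ f) {w} ¬Pw with P? u
    ... | no _   = coefficient-filter⁻ f ¬Pw
    ... | yes Pu = R.trans
      (coefficient-other r {u} {w} (filter (P? ∘ proj₂) f)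
        λ u≡w → ¬Pw (subst P (toList-injective u≡w) Pu))
      (coefficient-filter⁻ f ¬Pw)

    evalPolynomial-split : ∀ f ρ → evalPolynomial A ρ f ≈ᴹ
      evalPolynomial A ρ (filter (P? ∘ proj₂) f) +ᴹ
      evalPolynomial A ρ (filter (¬? ∘ P? ∘ proj₂) f)
    evalPolynomial-split []            ρ = ≈ᴹ-sym (+ᴹ-identityʳ 0ᴹ)
    evalPolynomial-split ((r , u) ∷ f) ρ with P? u
    ... | yes _ = ≈ᴹ-trans (+ᴹ-congˡ (evalPolynomial-split f ρ)) (≈ᴹ-sym (+ᴹ-assoc _ _ _))
    ... | no _  = ≈ᴹ-trans (+ᴹ-congˡ (evalPolynomial-split f ρ)) (x∙yz≈y∙xz _ _ _)

  -- Terms with the same word may cancel without being zero one by one. All terms with the word of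
  -- the first term are collected and removed, which shortens the list.
  zero-coefficients⇒0 : ∀ f → Acc _<_ (length f) → (∀ w → coefficient R f w ≈ 0#) →
                        ∀ ρ → evalPolynomial A ρ f ≈ᴹ 0ᴹ
  zero-coefficients⇒0 []              _        _  ρ = ≈ᴹ-refl
  zero-coefficients⇒0 f@((r , u) ∷ _) (acc rs) ≈0 ρ = begin
    evalPolynomial A ρ f
      ≈⟨ collect f u ρ ⟩
    coefficient R f u *ₗ evalWord A ρ u +ᴹ evalPolynomial A ρ (filter (differs? u) f)
      ≈⟨ +ᴹ-cong (≈ᴹ-trans (*ₗ-congʳ (≈0 u)) (*ₗ-zeroˡ _))
           (zero-coefficients⇒0 (filter (differs? u) f)
             (rs (List.filter-notAll (differs? u) f (here λ ≢ → ≢ refl))) filtered≈0 ρ) ⟩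
    0ᴹ +ᴹ 0ᴹ
      ≈⟨ +ᴹ-identityʳ 0ᴹ ⟩
    0ᴹ ∎
    where
    ≢u? : Decidable (λ (v : Word ℕ) → toList v ≢ toList u)
    ≢u? v = ¬? (equal? v u)
    filtered≈0 : ∀ w → coefficient R (filter (differs? u) f) w ≈ 0#
    filtered≈0 w with equal? w u
    ... | yes w≡u = coefficient-filter⁻ ≢u? f (λ ≢ → ≢ w≡u)
    ... | no  w≢u = R.trans (coefficient-filter⁺ ≢u? f w≢u) (≈0 w)

  -- The terms longer than w have total coefficients 0 and are dropped; then the terms with word w
  -- are collected into a single one with coefficient 1.
  isolate : ∀ f w → coefficient R f w ≈ 1# →
            (∀ v → List⁺.length w < List⁺.length v → coefficient R f v ≈ 0#) →
            ∃[ f′ ] ((∀ ρ → evalPolynomial A ρ f ≈ᴹ evalWord A ρ w +ᴹ evalPolynomial A ρ f′) ×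
                     All (λ (_ , u) → toList u ≢ toList w × List⁺.length u ≤ List⁺.length w) f′)
  isolate f w ≈1 long≈0 = filter (differs? w) bounded , eval≈ ,
    All.zip (All.all-filter (differs? w) bounded ,
             All.filter⁺ (differs? w) (All.map ≮⇒≥ (All.all-filter (¬? ∘ long? ∘ proj₂) f)))
    where
    long? : Decidable (λ (v : Word ℕ) → List⁺.length w < List⁺.length v)
    long? v = List⁺.length w <? List⁺.length v
    bounded = filter (¬? ∘ long? ∘ proj₂) f
    long  = filter (long? ∘ proj₂) f
    coefficient-long : ∀ v → coefficient R long v ≈ 0#
    coefficient-long v with long? v
    ... | yes lt = R.trans (coefficient-filter⁺ long? f lt) (long≈0 v lt)
    ... | no ≮   = coefficient-filter⁻ long? f ≮
    eval≈ : ∀ ρ → evalPolynomial A ρ f ≈ᴹ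
                  evalWord A ρ w +ᴹ evalPolynomial A ρ (filter (differs? w) bounded)
    eval≈ ρ = begin
      evalPolynomial A ρ f
        ≈⟨ evalPolynomial-split long? f ρ ⟩
      evalPolynomial A ρ long +ᴹ evalPolynomial A ρ bounded
        ≈⟨ +ᴹ-congʳ (zero-coefficients⇒0 long (<-wellFounded _) coefficient-long ρ) ⟩
      0ᴹ +ᴹ evalPolynomial A ρ bounded
        ≈⟨ +ᴹ-identityˡ _ ⟩
      evalPolynomial A ρ bounded
        ≈⟨ collect bounded w ρ ⟩
      coefficient R bounded w *ₗ evalWord A ρ w +ᴹ evalPolynomial A ρ (filter (differs? w) bounded)
        ≈⟨ +ᴹ-congʳ (*ₗ-congʳ (R.trans
             (coefficient-filter⁺ (¬? ∘ long?) f (<-irrefl refl)) ≈1)) ⟩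
      1# *ₗ evalWord A ρ w +ᴹ evalPolynomial A ρ (filter (differs? w) bounded)
        ≈⟨ +ᴹ-congʳ (*ₗ-identityˡ _) ⟩
      evalWord A ρ w +ᴹ evalPolynomial A ρ (filter (differs? w) bounded) ∎

  -- Multilinearisation

  Terms : Set a → Set _
  Terms Z = List (Carrier × Word Z)

  evaluate : (Z → Carrierᴹ) → Terms Z → Carrierᴹ
  evaluate y []            = 0ᴹ
  evaluate y ((r , v) ∷ T) = r *ₗ evalWord A y v +ᴹ evaluate y T

  evaluate-++ : (y : Z → Carrierᴹ) → ∀ S T →
                evaluate y (S ++ T) ≈ᴹ evaluate y S +ᴹ evaluate y T
  evaluate-++ y []      T = ≈ᴹ-sym (+ᴹ-identityˡ _)
  evaluate-++ y (t ∷ S) T = ≈ᴹ-trans (+ᴹ-congˡ (evaluate-++ y S T)) (≈ᴹ-sym (+ᴹ-assoc _ _ _))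

  Vanishes : Terms Z → Set _
  Vanishes T = ∀ y → evaluate y T ≈ᴹ 0ᴹ

  ∑ : List Carrierᴹ → Carrierᴹ
  ∑ = foldr _+ᴹ_ 0ᴹ

  ∑-++ : ∀ xs ys → ∑ (xs ++ ys) ≈ᴹ ∑ xs +ᴹ ∑ ys
  ∑-++ []       ys = ≈ᴹ-sym (+ᴹ-identityˡ _)
  ∑-++ (x ∷ xs) ys = ≈ᴹ-trans (+ᴹ-congˡ (∑-++ xs ys)) (≈ᴹ-sym (+ᴹ-assoc _ _ _))

  module _ (pos : ℕ → List Z) (y : Z → Carrierᴹ) where

    eval : Word Z → Carrierᴹ
    eval = evalWord A y

    merged : ℕ → Carrierᴹ
    merged i = ∑ (map y (pos i))

    ∑-∷⁺ : ∀ j vs → ∑ (map eval (map (j ∷⁺_) vs)) ≈ᴹ y j ∙ ∑ (map eval vs)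
    ∑-∷⁺ j []       = ≈ᴹ-sym (A.zeroʳ (y j))
    ∑-∷⁺ j (v ∷ vs) = ≈ᴹ-trans (+ᴹ-congˡ (∑-∷⁺ j vs)) (≈ᴹ-sym (A.distribˡ (y j) _ _))

    ∑-product : ∀ js vs → ∑ (map y js) ∙ ∑ (map eval vs) ≈ᴹ
                          ∑ (map eval (cartesianProductWith _∷⁺_ js vs))
    ∑-product []       vs = A.zeroˡ _
    ∑-product (j ∷ js) vs = begin
      (y j +ᴹ ∑ (map y js)) ∙ V          ≈⟨ A.distribʳ V _ _ ⟩
      y j ∙ V +ᴹ ∑ (map y js) ∙ V        ≈⟨ +ᴹ-cong (≈ᴹ-sym (∑-∷⁺ j vs)) (∑-product js vs) ⟩
      ∑ (map eval j∷vs) +ᴹ ∑ (map eval js∷vs)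
        ≈⟨ ∑-++ (map eval j∷vs) _ ⟨
      ∑ (map eval j∷vs ++ map eval js∷vs)
        ≡⟨ cong ∑ (List.map-++ eval j∷vs js∷vs) ⟨
      ∑ (map eval (j∷vs ++ js∷vs)) ∎
      where
      V     = ∑ (map eval vs)
      j∷vs  = map (j ∷⁺_) vs
      js∷vs = cartesianProductWith _∷⁺_ js vs

    evalWord-merged : ∀ x xs → evalWord A merged (x ∷ xs) ≈ᴹ ∑ (map eval (expand pos x xs))
    evalWord-merged x []        = ≈ᴹ-reflexive (cong ∑ (List.map-∘ (pos x)))
    evalWord-merged x (x′ ∷ xs) = ≈ᴹ-trans (A.*-cong ≈ᴹ-refl (evalWord-merged x′ xs))
                                           (∑-product (pos x) (expand pos x′ xs))

    evaluate-scaled : ∀ r vs → evaluate y (map (r ,_) vs) ≈ᴹ r *ₗ ∑ (map eval vs)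
    evaluate-scaled r []       = ≈ᴹ-sym (*ₗ-zeroʳ r)
    evaluate-scaled r (v ∷ vs) = ≈ᴹ-trans (+ᴹ-congˡ (evaluate-scaled r vs))
                                          (≈ᴹ-sym (*ₗ-distribˡ r _ _))

  expandTerms : (ℕ → List Z) → Polynomial R → Terms Z
  expandTerms pos []                  = []
  expandTerms pos ((r , x ∷ xs) ∷ f) = map (r ,_) (expand pos x xs) ++ expandTerms pos f

  evaluate-expandTerms : (pos : ℕ → List Z) (y : Z → Carrierᴹ) → ∀ f →
    evaluate y (expandTerms pos f) ≈ᴹ evalPolynomial A (merged pos y) f
  evaluate-expandTerms pos y []                  = ≈ᴹ-refl
  evaluate-expandTerms pos y ((r , x ∷ xs) ∷ f) = begin
    evaluate y (map (r ,_) (expand pos x xs) ++ expandTerms pos f)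
      ≈⟨ evaluate-++ y (map (r ,_) (expand pos x xs)) _ ⟩
    evaluate y (map (r ,_) (expand pos x xs)) +ᴹ evaluate y (expandTerms pos f)
      ≈⟨ +ᴹ-cong (≈ᴹ-trans (evaluate-scaled pos y r (expand pos x xs))
                           (*ₗ-congˡ (≈ᴹ-sym (evalWord-merged pos y x xs))))
                 (evaluate-expandTerms pos y f) ⟩
    r *ₗ evalWord A (merged pos y) (x ∷ xs) +ᴹ evalPolynomial A (merged pos y) f ∎

  All-expandTerms : ∀ {pos : ℕ → List Z} {Q : Pred (Word Z) q} {f} →
    All (λ (_ , u) → All Q (expand pos (List⁺.head u) (List⁺.tail u))) f →
    All (Q ∘ proj₂) (expandTerms pos f)
  All-expandTerms []       = []
  All-expandTerms (q ∷ qs) = All.++⁺ (All.map⁺ q) (All-expandTerms qs)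

  -- To be used with `y′` equal to `y` except for one letter sent to 0, and with P the property of
  -- containing that letter.
  evaluate-split : {P : Pred (Word Z) p} (P? : Decidable P) {y y′ : Z → Carrierᴹ} →
                   (∀ {v} → P v → evalWord A y′ v ≈ᴹ 0ᴹ) →
                   (∀ {v} → ¬ P v → evalWord A y′ v ≈ᴹ evalWord A y v) → ∀ T →
                   evaluate y T ≈ᴹ evaluate y (filter (P? ∘ proj₂) T) +ᴹ evaluate y′ T
  evaluate-split P? {y} {y′} ≈0 ≈y []            = ≈ᴹ-sym (+ᴹ-identityʳ 0ᴹ)
  evaluate-split P? {y} {y′} ≈0 ≈y ((r , v) ∷ T) with P? v
  ... | yes Pv = begin
    r *ₗ evalWord A y v +ᴹ evaluate y T          ≈⟨ +ᴹ-congˡ (evaluate-split P? ≈0 ≈y T) ⟩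
    r *ₗ evalWord A y v +ᴹ (F +ᴹ E)              ≈⟨ +ᴹ-assoc _ _ _ ⟨
    (r *ₗ evalWord A y v +ᴹ F) +ᴹ E              ≈⟨ +ᴹ-congˡ (+ᴹ-identityˡ E) ⟨
    (r *ₗ evalWord A y v +ᴹ F) +ᴹ (0ᴹ +ᴹ E)
      ≈⟨ +ᴹ-congˡ (+ᴹ-congʳ (≈ᴹ-trans (*ₗ-congˡ (≈0 Pv)) (*ₗ-zeroʳ r))) ⟨
    (r *ₗ evalWord A y v +ᴹ F) +ᴹ (r *ₗ evalWord A y′ v +ᴹ E) ∎
    where
    F = evaluate y (filter (P? ∘ proj₂) T)
    E = evaluate y′ T
  ... | no ¬Pv = begin
    r *ₗ evalWord A y v +ᴹ evaluate y T
      ≈⟨ +ᴹ-cong (*ₗ-congˡ (≈ᴹ-sym (≈y ¬Pv))) (evaluate-split P? ≈0 ≈y T) ⟩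
    r *ₗ evalWord A y′ v +ᴹ (F +ᴹ E)
      ≈⟨ x∙yz≈y∙xz _ _ _ ⟩
    F +ᴹ (r *ₗ evalWord A y′ v +ᴹ E) ∎
    where
    F = evaluate y (filter (P? ∘ proj₂) T)
    E = evaluate y′ T

  module _ (_≟ᶻ_ : DecidableEquality Z) where
    open DecMembership _≟ᶻ_ using (_∈?_)

    has? : ∀ j → Decidable (λ ((_ , v) : Carrier × Word Z) → j ∈ toList v)
    has? j (_ , v) = j ∈? toList v

    full? : ∀ js → Decidable (λ ((_ , v) : Carrier × Word Z) → All (_∈ toList v) js)
    full? js (_ , v) = All.all? (_∈? toList v) js

    erase : Z → (Z → Carrierᴹ) → Z → Carrierᴹ
    erase j y z = if does (z ≟ᶻ j) then 0ᴹ else y z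

    erase-here : ∀ j y → erase j y j ≈ᴹ 0ᴹ
    erase-here j y with j ≟ᶻ j
    ... | yes _  = ≈ᴹ-refl
    ... | no j≢j = contradiction refl j≢j

    erase-there : ∀ j y z → j ≢ z → erase j y z ≈ᴹ y z
    erase-there j y z j≢z with z ≟ᶻ j
    ... | yes z≡j = contradiction (sym z≡j) j≢z
    ... | no _    = ≈ᴹ-refl

    evalWord-erased : ∀ j y v → j ∈ toList v → evalWord A (erase j y) v ≈ᴹ 0ᴹ
    evalWord-erased j y (_ ∷ [])    (here refl) = erase-here j y
    evalWord-erased j y (_ ∷ _ ∷ _) (here refl) =
      ≈ᴹ-trans (A.*-cong (erase-here j y) ≈ᴹ-refl) (A.zeroˡ _)
    evalWord-erased j y (_ ∷ z ∷ v) (there j∈) =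
      ≈ᴹ-trans (A.*-cong ≈ᴹ-refl (evalWord-erased j y (z ∷ v) j∈)) (A.zeroʳ _)

    -- Sending the letter j to 0 kills the words containing j and leaves the others unchanged.
    -- Subtracting this instance of the identity keeps just the words that contain j.
    Vanishes-has : ∀ T j → Vanishes T → Vanishes (filter (has? j) T)
    Vanishes-has T j T≈0 y = begin
      evaluate y (filter (has? j) T)                              ≈⟨ +ᴹ-identityʳ _ ⟨
      evaluate y (filter (has? j) T) +ᴹ 0ᴹ                        ≈⟨ +ᴹ-congˡ (T≈0 _) ⟨
      evaluate y (filter (has? j) T) +ᴹ evaluate (erase j y) T
        ≈⟨ evaluate-split (λ v → j ∈? toList v) (evalWord-erased j y _) (λ {v} j∉ →
             evalWord-cong v (All.map (erase-there j y _) (All.¬Any⇒All¬ _ j∉))) T ⟨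
      evaluate y T                                                ≈⟨ T≈0 y ⟩
      0ᴹ                                                          ∎

    Vanishes-full : ∀ js T → Vanishes T → Vanishes (filter (full? js) T)
    Vanishes-full []       T T≈0 = subst Vanishes
      (sym (List.filter-all (full? []) (All.universal (λ _ → []) T))) T≈0
    Vanishes-full (j ∷ js) T T≈0 = subst Vanishes
      (filter-× (has? j) (full? js) (full? (j ∷ js)) _∷_ All.uncons T)
      (Vanishes-full js (filter (has? j) T) (Vanishes-has T j T≈0))

  Span-evaluate : ∀ {P : Pred Carrierᴹ p} {y : Z → Carrierᴹ} {T} →
                  All (λ (_ , v) → P (evalWord A y v)) T → Span A P (evaluate y T)
  Span-evaluate []       = zero
  Span-evaluate (p ∷ ps) = add (scale _ (element p)) (Span-evaluate ps)

  identityWord : ∀ n → Word (Fin (suc n))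
  identityWord n = Fin.zero ∷ tabulate Fin.suc

  data Permuted {n} (y : Fin (suc n) → Carrierᴹ) : Pred Carrierᴹ m where
    permuted : ∀ v → toList v ↭ allFin (suc n) → toList v ≢ allFin (suc n) →
               Permuted y (evalWord A y v)

  -- Each variable is replaced by the sum of the yⱼ over its places j in the leading monomial w, and
  -- only the words containing every yⱼ are kept. Having at most n + 1 letters, these are
  -- permutations of y₀⋯yₙ, and the identity permutation arises from w alone.
  multilinearise : ∀ {n} f → Admissible R f (suc n) → IsIdentity A f →
                   ∀ y → Span A (Permuted y) (evalWord A y (identityWord n))
  multilinearise f (long≈0 , w@(x ∷ xs) , refl , ≈1) f≈0 y
    with f′ , f≈ , f′-short ← isolate f w ≈1 long≈0
    with as , bs , expand≡ , as≢ , bs≢ ← Unique-split (Unique-expand (positions-Unique (lookup (x ∷ xs))) x xs)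
           (∈-expand⁺ {letter = lookup (x ∷ xs)} (∈-positions⁺ (lookup (x ∷ xs))) x xs (identityWord (length xs)) (map-lookup-allFin (x ∷ xs)))
    -- The other terms form three groups: the words before and after the identity word in the
    -- expansion of w, and the words from the remaining monomials.
    = Span-cancel sum≈0 (add (span as≢ (λ v∈ → subst (_ ∈_) (sym expand≡) (∈-++⁺ˡ v∈)))
                      (add (span bs≢ (λ v∈ → subst (_ ∈_) (sym expand≡) (∈-++⁺ʳ as (there v∈))))
                           (Span-evaluate (All.map (λ {t} → permuted-term {t}) (All.zip
                             (All.filter⁺ full (All-expandTerms (All.map (λ {t} → other-words {t}) f′-short)) ,
                              All.all-filter full (expandTerms pos f′)))))))
    where
    n    = length xs
    pos  = positions (lookup (x ∷ xs))
    id   = identityWord n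
    full = full? Fin._≟_ (allFin (suc n))

    Other : Pred (Word (Fin (suc n))) _
    Other v = toList v ≢ allFin (suc n) × length (toList v) ≤ suc n

    permuted-term : ∀ {t : Carrier × Word (Fin (suc n))} →
      Other (proj₂ t) × All (_∈ toList (proj₂ t)) (allFin (suc n)) → Permuted y (evalWord A y (proj₂ t))
    permuted-term {_ , v} ((v≢ , |v|≤) , full-v) = permuted v
      (↭-of-length (Unique.allFin⁺ (suc n)) full-v
        (≤-trans |v|≤ (≤-reflexive (sym (length-allFin (suc n)))))) v≢

    |expand| : ∀ {u v} → v ∈ expand pos (List⁺.head u) (List⁺.tail u) →
               length (toList v) ≡ List⁺.length u
    |expand| {u} {v} v∈ = trans (sym (List.length-map (lookup (x ∷ xs)) (toList v)))
      (cong length (∈-expand⁻ (∈-positions⁻ (lookup (x ∷ xs))) (List⁺.head u) (List⁺.tail u) v∈))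

    other-words : ∀ {t : Carrier × Word ℕ} →
      toList (proj₂ t) ≢ toList w × List⁺.length (proj₂ t) ≤ suc n →
      All Other (expand pos (List⁺.head (proj₂ t)) (List⁺.tail (proj₂ t)))
    other-words {_ , u} (u≢w , |u|≤) = All.tabulate λ v∈ →
      (λ v≡id → u≢w (trans (sym (∈-expand⁻ (∈-positions⁻ (lookup (x ∷ xs))) (List⁺.head u) (List⁺.tail u) v∈))
        (trans (cong (map (lookup (x ∷ xs))) v≡id) (map-lookup-allFin (x ∷ xs))))) ,
      ≤-trans (≤-reflexive (|expand| {u} v∈)) |u|≤

    terms : List (Word (Fin (suc n))) → Terms (Fin (suc n))
    terms vs = filter full (map (1# ,_) vs)

    span : ∀ {vs} → All (id ≢_) vs → (∀ {v} → v ∈ vs → v ∈ expand pos x xs) →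
           Span A (Permuted y) (evaluate y (terms vs))
    span {vs} vs≢ vs⊆ = Span-evaluate (All.map (λ {t} → permuted-term {t}) (All.zip
      (All.filter⁺ full (All.map⁺ (All.tabulate λ v∈ →
         (λ v≡id → All.lookup vs≢ v∈ (sym (toList-injective v≡id))) ,
         ≤-reflexive (|expand| {w} (vs⊆ v∈)))) ,
       All.all-filter full (map (1# ,_) vs))))

    T = expandTerms pos ((1# , w) ∷ f′)

    T-vanishes : Vanishes T
    T-vanishes z = begin
      evaluate z T
        ≈⟨ evaluate-expandTerms pos z ((1# , w) ∷ f′) ⟩
      1# *ₗ evalWord A (merged pos z) w +ᴹ evalPolynomial A (merged pos z) f′
        ≈⟨ +ᴹ-congʳ (*ₗ-identityˡ _) ⟩
      evalWord A (merged pos z) w +ᴹ evalPolynomial A (merged pos z) f′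
        ≈⟨ f≈ (merged pos z) ⟨
      evalPolynomial A (merged pos z) f
        ≈⟨ f≈0 (merged pos z) ⟩
      0ᴹ ∎

    full-T : filter full T ≡ terms as ++ (1# , id) ∷ (terms bs ++ filter full (expandTerms pos f′))
    full-T = trans
      (cong (λ vs → filter full (map (1# ,_) vs ++ expandTerms pos f′)) expand≡)
      (filter-map-split full (1# ,_) (All.tabulate λ j∈ → j∈) as bs (expandTerms pos f′))

    sum≈0 : evalWord A y id +ᴹ (evaluate y (terms as) +ᴹ
              (evaluate y (terms bs) +ᴹ evaluate y (filter full (expandTerms pos f′)))) ≈ᴹ 0ᴹ
    sum≈0 = begin
      evalWord A y id +ᴹ (evaluate y (terms as) +ᴹ
        (evaluate y (terms bs) +ᴹ evaluate y (filter full (expandTerms pos f′))))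
        ≈⟨ +ᴹ-cong (≈ᴹ-sym (*ₗ-identityˡ _)) (+ᴹ-congˡ (≈ᴹ-sym (evaluate-++ y (terms bs) _))) ⟩
      1# *ₗ evalWord A y id +ᴹ (evaluate y (terms as) +ᴹ evaluate y later)
        ≈⟨ x∙yz≈y∙xz _ _ _ ⟩
      evaluate y (terms as) +ᴹ evaluate y ((1# , id) ∷ later)
        ≈⟨ evaluate-++ y (terms as) _ ⟨
      evaluate y (terms as ++ (1# , id) ∷ later)
        ≡⟨ cong (evaluate y) full-T ⟨
      evaluate y (filter full T)
        ≈⟨ Vanishes-full Fin._≟_ (allFin (suc n)) T T-vanishes y ⟩
      0ᴹ ∎
      where later = terms bs ++ filter full (expandTerms pos f′)

  -- Spanning by words and rewriting of divisible words

  module _ {l} (g : Fin l → Carrierᴹ) where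

    value-of : Word (Fin l) → Carrierᴹ
    value-of = evalWord A g

    IsWordValue : Pred Carrierᴹ ℓm
    IsWordValue a = ∃[ w ] (a ≈ᴹ value-of w)

    Subalgebra⇒Span : ∀ {a} → Subalgebra A g a → Span A IsWordValue a
    Subalgebra⇒Span (generator i)  = element (List⁺.[ i ] , ≈ᴹ-refl)
    Subalgebra⇒Span zero           = zero
    Subalgebra⇒Span (add s t)      = add (Subalgebra⇒Span s) (Subalgebra⇒Span t)
    Subalgebra⇒Span (scale r s)    = scale r (Subalgebra⇒Span s)
    Subalgebra⇒Span (resp eq s)    = resp eq (Subalgebra⇒Span s)
    Subalgebra⇒Span (multiply {x} {y} s t) =
      Linear.Span-map (∙-linearʳ y) (λ {x′} → products {x′}) (Subalgebra⇒Span s)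
      where
      products : ∀ {x} → IsWordValue x → Span A IsWordValue (x ∙ y)
      products {x} (u , x≈) = Linear.Span-map (∙-linearˡ x) (λ (v , y≈) →
        element (u ⁺++⁺ v , ≈ᴹ-trans (A.*-cong x≈ y≈)
          (≈ᴹ-sym (evalWord-⁺++⁺ g (List⁺.head u) (List⁺.tail u) v)))) (Subalgebra⇒Span t)

    Divisible⇒Span : ∀ {n} {P : Pred Carrierᴹ p} f → Admissible R f (suc n) → IsIdentity A f →
      ∀ w → Divisible (suc n) (toList w) →
      (∀ v → toList w ⋗ toList v → Span A P (value-of v)) → Span A P (value-of w)
    Divisible⇒Span {n = n} {P = P} f adm f≈0 w (s , us@(_ ∷ _) , w≡ , refl , us≻) smaller =
      resp (≈ᴹ-sym (≈ᴹ-trans (≈ᴹ-reflexive (cong value-of w≡id)) (value-rearranged (identityWord n))))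
           -- The identity is applied to the values of the words uᵢ, and `act g s` puts the prefix s
           -- back in front of every summand.
           (Linear.Span-map (act-linear g s) image
             (multilinearise f adm f≈0 (value-of ∘ U)))
      where
      U : Fin (suc n) → Word (Fin l)
      U = lookup us

      rearranged : Word (Fin (suc n)) → Word (Fin l)
      rearranged v = s ++⁺ List⁺.concat (List⁺.map U v)

      toList-rearranged : ∀ v → toList (rearranged v) ≡ s ++ concat (map (toList ∘ U) (toList v))
      toList-rearranged v = trans (toList-++⁺ s _)
        (cong (λ z → s ++ concat z) (sym (List.map-∘ {g = toList} {f = U} (toList v))))

      w≡id : w ≡ rearranged (identityWord n)
      w≡id = toList-injective (trans w≡ (sym (trans (toList-rearranged (identityWord n))
        (cong (λ z → s ++ concat z) (trans (List.map-∘ (allFin (suc n)))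
          (cong (map toList) (map-lookup-allFin us)))))))

      value-rearranged : ∀ v → value-of (rearranged v) ≈ᴹ act g s (evalWord A (value-of ∘ U) v)
      value-rearranged v = ≈ᴹ-trans (evalWord-++⁺ g s _)
        (Linear.φ-cong (act-linear g s)
          (≈ᴹ-sym (evalWord-concat g U (List⁺.head v) (List⁺.tail v))))

      decreasing : AllPairs (_≻_ on (toList ∘ U)) (allFin (suc n))
      decreasing = AllPairs.map⁻ (subst (AllPairs (_≻_ on toList)) (sym (map-lookup-allFin us)) us≻)

      w≡ᴸ : toList w ≡ s ++ concat (map (toList ∘ U) (allFin (suc n)))
      w≡ᴸ = trans (cong toList w≡id) (toList-rearranged (identityWord n))

      length-rearranged : ∀ v → length (toList (rearranged v)) ≡
                                length s + length (concat (map (toList ∘ U) (toList v)))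
      length-rearranged v = trans (cong length (toList-rearranged v)) (List.length-++ s)

      image : ∀ {x} → Permuted (value-of ∘ U) x → Span A P (act g s x)
      image (permuted v σ v≢) = resp (value-rearranged v) (smaller (rearranged v)
        ( subst₂ _≻_ (sym w≡ᴸ) (sym (toList-rearranged v))
            (≻-++ˡ s (permuted-≻ Fin._≟_ (toList ∘ U) σ v≢ decreasing))
        , trans (length-rearranged v)
            (trans (cong (length s +_) (permuted-length (toList ∘ U) σ))
                   (sym (trans (cong length w≡ᴸ) (List.length-++ s))))))

    -- From alternating words to essential products

    shortWords : ℕ → List Carrierᴹ
    shortWords N = cartesianProductWith (λ x w → value-of (x ∷ w)) (allFin l) (wordsUpTo l N)

    module _ (n N : ℕ) where
      open Membership ≈ᴹ-setoid using () renaming (_∈_ to _∈ᴹ_)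

      EssentialFactor : Set _
      EssentialFactor = Factor A (WordsShorterThan A n g) (shortWords N)

      ∈-shortWords : ∀ x w → length (x ∷ w) ≤ N → value-of (x ∷ w) ∈ᴹ shortWords N
      ∈-shortWords x w le = Any.map ≈ᴹ-reflexive
        (∈-cartesianProductWith⁺ _ (∈-allFin x) (∈-wordsUpTo w (≤-trans (n≤1+n _) le)))

      wordPower : Word (Fin l) → ℕ → Word (Fin l)
      wordPower u zero    = u
      wordPower u (suc k) = u ⁺++⁺ wordPower u k

      toList-wordPower : ∀ u k → toList (wordPower u k) ≡ pow (toList u) (suc k)
      toList-wordPower u zero    = sym (List.++-identityʳ (toList u))
      toList-wordPower u (suc k) = cong (toList u ++_) (toList-wordPower u k)

      value-wordPower : ∀ u k → _^⁺_ A (value-of u) k ≈ᴹ value-of (wordPower u k)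
      value-wordPower u zero    = ≈ᴹ-refl
      value-wordPower u (suc k) = ≈ᴹ-trans (A.*-cong ≈ᴹ-refl (value-wordPower u k))
        (≈ᴹ-sym (evalWord-⁺++⁺ g (List⁺.head u) (List⁺.tail u) (wordPower u k)))

      data Factors : List EssentialFactor → List (Fin l) → Set (c Level.⊔ m Level.⊔ ℓm) where
        []  : Factors [] []
        _∷_ : ∀ {t ts w v} → value A t ≈ᴹ value-of v × w ≡ toList v → ∀ {w′} → Factors ts w′ →
              Factors (t ∷ ts) (w ++ w′)

      Factorisation : ℕ → ℕ → List (Fin l) → Set _
      Factorisation b h w = ∃[ ts ] (Factors ts w × length ts ≤ b × countPowers A ts ≤ h)

      -- An empty gap has no value in an algebra without unit, so it contributes no factor; the
      -- bound on the number of factors grows in either case.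
      add-gap : ∀ {b h} w {w′} → length w ≤ N → Factorisation b h w′ →
                Factorisation (suc b) h (w ++ w′)
      add-gap []      _  (ts , fs , |ts| , powers) = ts , fs , m≤n⇒m≤1+n |ts| , powers
      add-gap (x ∷ w) le (ts , fs , |ts| , powers) =
        fromD (∈-shortWords x w le) ∷ ts ,
        _∷_ {v = x ∷ w} (≈ᴹ-refl , refl) fs , s≤s |ts| , powers

      add-power : ∀ {b h} u k {w} → List⁺.length u < n → Factorisation b h w →
                  Factorisation (suc b) (suc h) (pow (toList u) (suc k) ++ w)
      add-power u k |u|<n (ts , fs , |ts| , powers) =
        power (u , |u|<n , ≈ᴹ-refl) k ∷ ts ,
        _∷_ {v = wordPower u k} (value-wordPower u k , sym (toList-wordPower u k)) fs ,
        s≤s |ts| , s≤s powers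

      -- At most h powers are surrounded by at most h + 1 gaps, which makes 2h + 1 factors. Every
      -- single gap is at most as long as all gaps together, hence lies in `D` when it is nonempty.
      Alternating⇒Factorisation : ∀ {h s w} → s ≤ N → Alternating n h s w →
                                  Factorisation (2 * h + 1) h w
      Alternating⇒Factorisation {h} s≤N (gap {w = w} le) =
        subst₂ (λ b w → Factorisation b h w) (+-comm 1 (2 * h)) (List.++-identityʳ w)
          (add-gap w (≤-trans le s≤N) ([] , [] , z≤n , z≤n))
      Alternating⇒Factorisation s≤N (power {h} {w = w} gp u k |u|<n le p) =
        subst (λ b → Factorisation b (suc h) (gp ++ pow (toList u) (suc k) ++ w)) (cong (_+ 1) (sym (*-suc 2 h)))
          (add-gap gp (≤-trans (m≤m+n _ _) (≤-trans le s≤N))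
            (add-power u k |u|<n (Alternating⇒Factorisation
              (≤-trans (m≤n+m _ (length gp)) (≤-trans le s≤N)) p)))

      product-Factors : ∀ {t ts w} → Factors (t ∷ ts) w →
        ∃[ v ] (toList v ≡ w × product A (List⁺.map (value A) (t ∷ ts)) ≈ᴹ value-of v)
      product-Factors (_∷_ {v = v} (t≈ , refl) []) =
        v , sym (List.++-identityʳ (toList v)) , t≈
      product-Factors (_∷_ {v = v} (t≈ , refl) fs@(_ ∷ _))
        with v′ , v′≡ , ts≈ ← product-Factors fs =
        v ⁺++⁺ v′ , cong (toList v ++_) v′≡ , ≈ᴹ-trans (A.*-cong t≈ ts≈)
          (≈ᴹ-sym (evalWord-⁺++⁺ g (List⁺.head v) (List⁺.tail v) v′))

      Alternating⇒EssentialProduct : ∀ {h} w → Alternating n h N (toList w) →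
        EssentialProduct A (WordsShorterThan A n g) (shortWords N) h (value-of w)
      Alternating⇒EssentialProduct w p = from-factors (Alternating⇒Factorisation ≤-refl p) refl
        where
        from-factors : ∀ {h w′} → Factorisation (2 * h + 1) h w′ → w′ ≡ toList w →
          EssentialProduct A (WordsShorterThan A n g) (shortWords N) h (value-of w)
        from-factors ([] , [] , _) ()
        from-factors (t ∷ ts , fs , |ts| , powers) eq with v , v≡ , ts≈ ← product-Factors fs =
          t ∷ ts , |ts| , powers ,
          ≈ᴹ-trans (≈ᴹ-reflexive (cong value-of (toList-injective (sym (trans v≡ eq)))))
                   (≈ᴹ-sym ts≈)

    -- Descent along ⋗: an alternating word is itself an essential product, and a divisible one is a
    -- combination of smaller words of the same length.
    reduce : ∀ {n} f → Admissible R f (suc n) → IsIdentity A f → ∀ w → Acc (flip _⋗_) (toList w) →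
      Span A (EssentialProduct A (WordsShorterThan A (suc n) g) (shortWords (gapLength l (suc n)))
               (suc (length (brokenRuns l (suc n)) * suc n)))
             (value-of w)
    reduce {n} f adm f≈0 w (acc rs) with dichotomy (suc n) (toList w)
    ... | inj₂ alternating =
      element (Alternating⇒EssentialProduct (suc n) (gapLength l (suc n)) w alternating)
    ... | inj₁ divisible   = Divisible⇒Span f adm f≈0 w divisible λ v w⋗v → reduce f adm f≈0 v (rs w⋗v)

    essential-height-bound : ∀ {n} f → Generates A g → Admissible R f (suc n) → IsIdentity A f →
      EssentialHeightAtMost A (WordsShorterThan A (suc n) g)
                              (suc (length (brokenRuns l (suc n)) * suc n))
    essential-height-bound {n} f gen adm f≈0 = shortWords (gapLength l (suc n)) , λ a →
      Span-bind (λ (w , x≈) → resp (≈ᴹ-sym x≈) (reduce f adm f≈0 w (⋗-wellFounded _)))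
                (Subalgebra⇒Span (gen a))

-- The numerical bound and the theorem

bound<Υ : ∀ n l → 1 ≤ l → suc (length (brokenRuns l (suc n)) * suc n) < Υ (suc n) l
bound<Υ n l 1≤l = begin-strict
  suc (length (brokenRuns l k) * k)  ≤⟨ s≤s (*-monoˡ-≤ k (length-brokenRuns l k)) ⟩
  -- Here Q = (l + 1)ᵏ l k is at least 1, so 1 + Q < 8Q; what remains is k ≤ k⁶.
  1 + Q                              <⟨ +-mono-<-≤ (s≤s 1≤Q) (m≤m+n Q (5 * Q)) ⟩
  (1 + Q) + 6 * Q                    ≤⟨ +-monoˡ-≤ (6 * Q) (+-monoˡ-≤ Q 1≤Q) ⟩
  (Q + Q) + 6 * Q                    ≡⟨ +-assoc Q Q (6 * Q) ⟩
  8 * Q                              ≡⟨ cong (8 *_) (trans (*-assoc P l k) (cong (P *_) (*-comm l k))) ⟩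
  8 * (P * (k * l))                  ≤⟨ *-monoʳ-≤ 8 (*-monoʳ-≤ P (*-monoˡ-≤ l (m≤m*n k (k ^ 5) {{m^n≢0 k 5}}))) ⟩
  8 * (P * (k ^ 6 * l))              ≡⟨ cong (8 *_) (sym (*-assoc P (k ^ 6) l)) ⟩
  8 * (P * k ^ 6 * l)                ≡⟨ *-assoc 8 (P * k ^ 6) l ⟨
  8 * (P * k ^ 6) * l                ≡⟨ cong (_* l) (*-assoc 8 P (k ^ 6)) ⟨
  8 * P * k ^ 6 * l                  ∎
  where
  open ≤-Reasoning
  k = suc n
  P = (l + 1) ^ k
  Q = P * l * k
  1≤Q : 1 ≤ Q
  1≤Q = *-mono-≤ (*-mono-≤ (m^n>0 (l + 1) {{>-nonZero (m≤n+m 1 l)}} k) 1≤l) (s≤s z≤n)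

-- For l = 0 the number `Υ n l` is 0 and no height lies below it; therefore at least one generator
-- is assumed.
mainTheorem3 : ∀ {c ℓ m ℓm} (R : CommutativeRing c ℓ) (A : AssociativeAlgebra R m ℓm)
    (n l : ℕ) → 1 ≤ l →
    (g : Fin l → AssociativeAlgebra.Carrierᴹ A) → Generates A g →
    (f : Polynomial R) → Admissible R f n → IsIdentity A f →
    EssentialHeightLessThan A (WordsShorterThan A n g) (Υ n l)
-- Degree 0 is impossible, since the leading monomial is a nonempty word.
mainTheorem3 R A zero    l 1≤l g gen f (_ , _ , () , _) f≈0
mainTheorem3 R A (suc n) l 1≤l g gen f adm f≈0 =
  (h , bound<Υ n l 1≤l , h-suffices) ,
  λ h′ (_ , least) → ≤-<-trans (least h h-suffices) (bound<Υ n l 1≤l)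
  where
  h = suc (length (brokenRuns l (suc n)) * suc n)
  h-suffices : EssentialHeightAtMost A (WordsShorterThan A (suc n) g) h
  h-suffices = essential-height-bound A g f gen adm f≈0
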